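{- For $I\subseteq N$, $|I|=k$, define $$\Psi_I=\sum_{\substack{F\in\mathcal F_{q-k+1}\\ N\setminus I\text{ is a spanning tree of }H_F}}w(F),\qquad \Psi_\varnothing:=\Phi_{\mathrm{valid}}.$$ Then the principal minors of the superport response matrix $L$ satisfy $$\det L[I,I]=\frac{\Psi_I}{\Phi_{\mathrm{valid}}}.$$
   Context: Network. $G=(V,E)$ is a finite connected simple undirected graph; each edge $e$ has a conductance $c_e\in\mathbb R_{>0}$. The weighted Laplacian $L_c$ is the $V\times V$ matrix with $(L_c)_{uu}=\sum_{e\ni u}c_e$, $(L_c)_{uv}=-c_{uv}$ if $uv\in E$, and $0$ otherwise. A spanning forest $F$ of $G$ is an acyclic subgraph with vertex set $V$ (isolated vertices allowed); $w(F)=\prod_{e\in F}c_e$; $\mathcal F_m$ is the set of spanning forests with exactly $m$ connected components. Matrix conventions. $A[S,T]$ is the submatrix with rows $S$ and columns $T$ in inherited order; empty determinants equal $1$. Superports. The boundary $M\subseteq V$ is nonempty and partitioned into nonempty superports $M=A_1\sqcup\cdots\sqcup A_p$. Choose a root $r_a\in A_a$ for each $a$; $R=\{r_1,\dots,r_p\}$, $N=M\setminus R$, $q=|N|$, $N=(x_1,\dots,x_q)$ in a fixed order; $r(x)$ is the root of the superport containing $x$. Superport response. Given $y\in\mathbb R^N$, consider voltages $U\in\mathbb R^V$ with $U_x-U_{r(x)}=y_x$ for all $x\in N$ whose incoming-current vector $\iota=L_cU$ satisfies $\iota_v=0$ for $v\notin M$ and $\sum_{v\in A_a}\iota_v=0$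 for every $a$. Put $j_x=\iota_x$ for $x\in N$ (the independent incoming currents). The linear map $y\mapsto j$ is the superport response and $L$ is its $q\times q$ matrix: $j=Ly$. Valid forests. A spanning forest is valid if identifying all boundary vertices within each superport (one vertex per superport) turns it into a spanning tree of the quotient network (loops and parallel edges count as cycles). $\Phi_{\mathrm{valid}}=\sum_{F\text{ valid}}w(F)$. Quotient port graph. For a spanning forest $F$, the quotient port multigraph $H_F$ has the connected components of $F$ as vertices, and each $x\in N$ gives a directed edge from the component containing $r(x)$ to the component containing $x$ (a loop if these coincide); subsets of $N$ are thereby regarded as edge sets of $H_F$. -}

module Defs where

open import Level using (_⊔_; 0ℓ) renaming (suc to lsuc)
open import Algebra.Apartness.Bundles using (HeytingField; HeytingCommutativeRing)
open import Algebra.Bundles using (CommutativeRing)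
import Algebra.Definitions.RawMonoid as RawMonoidDefinitions
open import Data.Bool.Base using (if_then_else_)
open import Data.Fin.Base using (Fin; zero; suc; toℕ; fromℕ; inject₁; punchIn; finToFun; funToFin)
open import Data.Fin.Properties using (any?; all?; injective⇒≤; finToFun-funToFin)
  renaming (_≟_ to _≟ᶠ_; suc-injective to sucᶠ-injective)
open import Data.Fin.Subset using (Subset; inside; outside; _∈_; _∉_; ∁; ∣_∣; ⊤)
open import Data.Fin.Subset.Properties using (_∈?_; nonempty?)
open import Data.List.Base using (List; []; _∷_; filter; allFin)
open import Data.List.Membership.Propositional using () renaming (_∈_ to _∈ˡ_)
open import Data.List.Membership.Propositional.Properties using (∈-filter⁺; ∈-filter⁻; ∈-allFin)
open import Data.List.Relation.Unary.Any using (here; there)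
open import Data.Nat.Base as ℕ using (ℕ; zero; suc; _∸_; NonZero)
import Data.Nat.Properties as ℕₚ
open import Data.Product.Base using (∃; ∃-syntax; Σ-syntax; _×_; _,_; proj₁; proj₂)
open import Data.Sum.Base using (_⊎_; inj₁; inj₂; [_,_]′)
import Data.Vec.Base as Vec
open import Data.Vec.Functional using (Vector)
open import Function.Base using (_∘_)
open import Function.Bundles using (Bijection; _⇔_)
open import Relation.Binary.Bundles using (Setoid)
open import Relation.Binary.Core using (Rel)
open import Relation.Binary.Construct.Closure.ReflexiveTransitive using (Star; ε; _◅_; _◅◅_; reverse)
open import Relation.Binary.PropositionalEquality as ≡ using (_≡_; _≢_; _≗_; refl; cong; subst)
open import Relation.Binary.Structures using (IsDecEquivalence; IsStrictPartialOrder)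
open import Relation.Nullary.Decidable
  using (Dec; yes; no; does; map′; ¬?; _×-dec_; _⊎-dec_; _→-dec_)
open import Relation.Nullary.Negation using (¬_; contradiction)

private
  variable
    n m p q k : ℕ

-- The standard library has no real numbers.  This is the usual notion of an
-- ordered field, with apartness in place of ≉ and cotransitivity (inherited
-- from _#_) in place of trichotomy, so that ℝ is an instance whether it is
-- treated classically or constructively.
record OrderedField c ℓ₁ ℓ₂ : Set (lsuc (c ⊔ ℓ₁ ⊔ ℓ₂)) where
  infix 4 _<_
  field
    heytingField : HeytingField c ℓ₁ ℓ₂

  open HeytingField heytingField public

  field
    _<_                  : Rel Carrier ℓ₂
    isStrictPartialOrder : IsStrictPartialOrder _≈_ _<_
    #⇔<⊎>                : ∀ {x y} → x # y ⇔ (x < y ⊎ y < x)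
    +-monoˡ-<            : ∀ {x y} z → x < y → x + z < y + z
    *-pos                : ∀ {x y} → 0# < x → 0# < y → 0# < x * y

  open HeytingCommutativeRing heytingCommutativeRing public using (commutativeRing)
  open CommutativeRing commutativeRing public using (+-rawMonoid; *-rawMonoid)
  open RawMonoidDefinitions +-rawMonoid public using () renaming (sum to ∑)
  open RawMonoidDefinitions *-rawMonoid public using () renaming (sum to ∏)

  -- #⇒invertible supplies the inverse of y - 0#.
  divide : (x y : Carrier) → y # 0# → Carrier
  divide x y y#0 = x * proj₁ (#⇒invertible y#0)

-- The vertices are the classes of _∼_, so that passing to a quotient of the
-- vertex set only changes _∼_.  The direction of an edge is recorded, but the
-- notions below ignore it.
record Multigraph (n m : ℕ) : Set₁ where
  infix 4 _∼_
  field
    _∼_              : Rel (Fin n) 0ℓ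
    isDecEquivalence : IsDecEquivalence _∼_
    src tgt          : Fin m → Fin n

  open IsDecEquivalence isDecEquivalence public
    renaming (refl to ∼-refl; sym to ∼-sym; trans to ∼-trans; _≟_ to _∼?_)

module _ (H : Multigraph n m) where
  open Multigraph H

  Joins : Fin m → Fin n → Fin n → Set
  Joins e u v = (src e ∼ u × tgt e ∼ v) ⊎ (src e ∼ v × tgt e ∼ u)

  -- Edge sets are identified with the spanning subgraphs they determine.
  module _ (T : Subset m) where

    Step : Rel (Fin n) 0ℓ
    Step u v = u ∼ v ⊎ (∃[ e ] e ∈ T × Joins e u v)

    Linked : Rel (Fin n) 0ℓ
    Linked = Star Step

    Connected : Set
    Connected = ∀ u v → Linked u v

    -- v₀ e₀ v₁ e₁ … eₗ vₗ₊₁ with vₗ₊₁ ∼ v₀ and no other repetition of a vertex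
    -- or an edge; ℓ = 0 is a loop, ℓ = 1 a pair of parallel edges.
    IsCycle : (ℓ : ℕ) → Vector (Fin n) (suc (suc ℓ)) → Vector (Fin m) (suc ℓ) → Set
    IsCycle ℓ v e =
      (∀ i → e i ∈ T) ×
      (∀ i → Joins (e i) (v (inject₁ i)) (v (suc i))) ×
      (v (fromℕ (suc ℓ)) ∼ v zero) ×
      (∀ i j → e i ≡ e j → i ≡ j) ×
      (∀ i j → v (inject₁ i) ∼ v (inject₁ j) → i ≡ j)

    Acyclic : Set
    Acyclic = ¬ (∃[ ℓ ] ∃[ v ] ∃[ e ] IsCycle ℓ v e)

    IsSpanningTree : Set
    IsSpanningTree = Connected × Acyclic

private
  anyVector? : ∀ {P : (Fin k → Fin n) → Set} → (∀ {f g} → f ≗ g → P f → P g) →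
               (∀ f → Dec (P f)) → Dec (∃ P)
  anyVector? resp P? = map′
    (λ (i , pi) → finToFun i , pi)
    (λ (f , pf) → funToFin f , resp (λ i → ≡.sym (finToFun-funToFin f i)) pf)
    (any? (P? ∘ finToFun))

  -- Finitely many edges, as a list, so that one can recurse on them.
  module Reach {n} {_∼_ : Rel (Fin n) 0ℓ} (eq : IsDecEquivalence _∼_)
               {E : Set} (s t : E → Fin n) where
    open IsDecEquivalence eq renaming (refl to ∼-refl; sym to ∼-sym; trans to ∼-trans)

    J : E → Rel (Fin n) 0ℓ
    J e u v = (s e ∼ u × t e ∼ v) ⊎ (s e ∼ v × t e ∼ u)

    R : List E → Rel (Fin n) 0ℓ
    R es = Star (λ u v → u ∼ v ⊎ (∃[ e ] e ∈ˡ es × J e u v))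

    Q : E → List E → Rel (Fin n) 0ℓ
    Q e es u v = R es u v ⊎ (R es u (s e) × R es (t e) v) ⊎ (R es u (t e) × R es (s e) v)

    weaken : ∀ {e es u v} → R es u v → R (e ∷ es) u v
    weaken ε = ε
    weaken (inj₁ x ◅ r) = inj₁ x ◅ weaken r
    weaken (inj₂ (e , i , j) ◅ r) = inj₂ (e , there i , j) ◅ weaken r

    ~step : ∀ {es u v} → u ∼ v → R es u v
    ~step x = inj₁ x ◅ ε

    prepend : ∀ {e es u w v} → R es u w → Q e es w v → Q e es u v
    prepend r (inj₁ x) = inj₁ (r ◅◅ x)
    prepend r (inj₂ (inj₁ (x , y))) = inj₂ (inj₁ (r ◅◅ x , y))
    prepend r (inj₂ (inj₂ (x , y))) = inj₂ (inj₂ (r ◅◅ x , y))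

    cross : ∀ {e es u w v} → J e u w → Q e es w v → Q e es u v
    cross (inj₁ (a , b)) (inj₁ x) = inj₂ (inj₁ (~step (∼-sym a) , ~step b ◅◅ x))
    cross (inj₁ (a , b)) (inj₂ (inj₁ (x , y))) = inj₂ (inj₁ (~step (∼-sym a) , y))
    cross (inj₁ (a , b)) (inj₂ (inj₂ (x , y))) = inj₁ (~step (∼-sym a) ◅◅ y)
    cross (inj₂ (a , b)) (inj₁ x) = inj₂ (inj₂ (~step (∼-sym b) , ~step a ◅◅ x))
    cross (inj₂ (a , b)) (inj₂ (inj₁ (x , y))) = inj₁ (~step (∼-sym b) ◅◅ y)
    cross (inj₂ (a , b)) (inj₂ (inj₂ (x , y))) = inj₂ (inj₂ (~step (∼-sym b) , y))

    split : ∀ {e es u v} → R (e ∷ es) u v → Q e es u v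
    split ε = inj₁ ε
    split (inj₁ x ◅ r) = prepend (~step x) (split r)
    split (inj₂ (_ , here refl , j) ◅ r) = cross j (split r)
    split (inj₂ (e′ , there i , j) ◅ r) = prepend (inj₂ (e′ , i , j) ◅ ε) (split r)

    join : ∀ {e es u v} → Q e es u v → R (e ∷ es) u v
    join (inj₁ x) = weaken x
    join {e} (inj₂ (inj₁ (x , y))) =
      weaken x ◅◅ inj₂ (e , here refl , inj₁ (∼-refl , ∼-refl)) ◅ weaken y
    join {e} (inj₂ (inj₂ (x , y))) =
      weaken x ◅◅ inj₂ (e , here refl , inj₂ (∼-refl , ∼-refl)) ◅ weaken y

    R? : ∀ es u v → Dec (R es u v)
    R? [] u v = map′ ~step go (u ≟ v)
      where
      go : ∀ {u v} → R [] u v → u ∼ v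
      go ε = ∼-refl
      go (inj₁ x ◅ r) = ∼-trans x (go r)
    R? (e ∷ es) u v = map′ join split
      (R? es u v ⊎-dec (R? es u (s e) ×-dec R? es (t e) v) ⊎-dec (R? es u (t e) ×-dec R? es (s e) v))

module _ (H : Multigraph n m) where
  open Multigraph H
  open Reach isDecEquivalence src tgt using (R; R?)

  joins? : ∀ e u v → Dec (Joins H e u v)
  joins? e u v = ((src e ∼? u) ×-dec (tgt e ∼? v)) ⊎-dec ((src e ∼? v) ×-dec (tgt e ∼? u))

  module _ (T : Subset m) where

    linked? : ∀ u v → Dec (Linked H T u v)
    linked? u v = map′ from to (R? (filter (_∈? T) (allFin m)) u v)
      where
      from : ∀ {u v} → R (filter (_∈? T) (allFin m)) u v → Linked H T u v
      from ε = ε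
      from (inj₁ x ◅ r) = inj₁ x ◅ from r
      from (inj₂ (e , i , j) ◅ r) =
        inj₂ (e , proj₂ (∈-filter⁻ (_∈? T) {xs = allFin m} i) , j) ◅ from r
      to : ∀ {u v} → Linked H T u v → R (filter (_∈? T) (allFin m)) u v
      to ε = ε
      to (inj₁ x ◅ r) = inj₁ x ◅ to r
      to (inj₂ (e , i , j) ◅ r) = inj₂ (e , ∈-filter⁺ (_∈? T) (∈-allFin e) i , j) ◅ to r

    linked-isDecEquivalence : IsDecEquivalence (Linked H T)
    linked-isDecEquivalence = record
      { isEquivalence = record
        { refl  = ε
        ; sym   = reverse λ where
            (inj₁ x)           → inj₁ (∼-sym x)
            (inj₂ (e , i , j)) → inj₂ (e , i , [ inj₂ , inj₁ ]′ j)
        ; trans = _◅◅_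
        }
      ; _≟_ = linked?
      }

    connected? : Dec (Connected H T)
    connected? = all? λ u → all? λ v → linked? u v

    private
      isCycle? : ∀ ℓ v e → Dec (IsCycle H T ℓ v e)
      isCycle? ℓ v e =
        (all? λ i → e i ∈? T) ×-dec
        (all? λ i → joins? (e i) (v (inject₁ i)) (v (suc i))) ×-dec
        (v (fromℕ (suc ℓ)) ∼? v zero) ×-dec
        (all? λ i → all? λ j → (e i ≟ᶠ e j) →-dec (i ≟ᶠ j)) ×-dec
        (all? λ i → all? λ j → (v (inject₁ i) ∼? v (inject₁ j)) →-dec (i ≟ᶠ j))

      isCycle-resp : ∀ {ℓ v v′ e e′} → v ≗ v′ → e ≗ e′ → IsCycle H T ℓ v e → IsCycle H T ℓ v′ e′
      isCycle-resp {ℓ} {v} {v′} {e} {e′} v≗ e≗ (a , b , c , d , f) =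
        (λ i → subst (_∈ T) (e≗ i) (a i)) ,
        joins′ ,
        ≡.subst₂ _∼_ (v≗ _) (v≗ _) c ,
        (λ i j eq → d i j (≡.trans (e≗ i) (≡.trans eq (≡.sym (e≗ j))))) ,
        (λ i j x → f i j (≡.subst₂ _∼_ (≡.sym (v≗ _)) (≡.sym (v≗ _)) x))
        where
        joins′ : ∀ i → Joins H (e′ i) (v′ (inject₁ i)) (v′ (suc i))
        joins′ i rewrite ≡.sym (e≗ i) | ≡.sym (v≗ (inject₁ i)) | ≡.sym (v≗ (suc i)) = b i

      cycleOfLength? : ∀ ℓ → Dec (∃[ v ] ∃[ e ] IsCycle H T ℓ v e)
      cycleOfLength? ℓ = anyVector?
        (λ v≗ (e , c) → e , isCycle-resp {e = e} v≗ (λ _ → refl) c)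
        (λ v → anyVector? (λ e≗ → isCycle-resp {v = v} (λ _ → refl) e≗) (isCycle? ℓ v))

    acyclic? : Dec (Acyclic H T)
    acyclic? = ¬? (map′
      (λ (ℓ , _ , c) → ℓ , c)
      (λ (ℓ , v , e , c) → ℓ , injective⇒≤ (λ {i} {j} → proj₁ (proj₂ (proj₂ (proj₂ c))) i j) , v , e , c)
      (ℕₚ.anyUpTo? cycleOfLength? m))

    isSpanningTree? : Dec (IsSpanningTree H T)
    isSpanningTree? = connected? ×-dec acyclic?

finSetoid : ℕ → Setoid 0ℓ 0ℓ
finSetoid k = ≡.setoid (Fin k)

private
  Classes : (_∼_ : Rel (Fin n) 0ℓ) → ℕ → Set
  Classes {n} _∼_ c = Σ[ f ∈ (Fin n → Fin c) ]
    (∀ {u v} → u ∼ v → f u ≡ f v) × (∀ {u v} → f u ≡ f v → u ∼ v) × (∀ y → ∃[ u ] f u ≡ y)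

  classes : ∀ {n} {_∼_ : Rel (Fin n) 0ℓ} → IsDecEquivalence _∼_ → ∃ (Classes _∼_)
  classes {zero} _ = 0 , (λ ()) , (λ {u} → λ { }) , (λ {u} → λ { }) , λ ()
  classes {suc n} {_∼_} eq
    with classes {n} {λ u v → suc u ∼ suc v} (record
           { isEquivalence = record { refl = ∼-refl ; sym = ∼-sym ; trans = ∼-trans }
           ; _≟_ = λ u v → suc u ≟ suc v })
       | any? (λ u → zero ≟ suc u)
    where open IsDecEquivalence eq renaming (refl to ∼-refl; sym to ∼-sym; trans to ∼-trans)
  ... | c , f , wd , inj , sur | yes (w , 0∼w) = c , g , (λ {u} {v} → g-wd u v) , (λ {u} {v} → g-inj u v) ,
        λ y → suc (proj₁ (sur y)) , proj₂ (sur y)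
    where
    open IsDecEquivalence eq renaming (refl to ∼-refl; sym to ∼-sym; trans to ∼-trans)
    g : Fin (suc n) → Fin c
    g zero = f w
    g (suc u) = f u
    g-wd : ∀ u v → u ∼ v → g u ≡ g v
    g-wd zero zero x = refl
    g-wd zero (suc v) x = wd (∼-trans (∼-sym 0∼w) x)
    g-wd (suc u) zero x = wd (∼-trans x 0∼w)
    g-wd (suc u) (suc v) x = wd x
    g-inj : ∀ u v → g u ≡ g v → u ∼ v
    g-inj zero zero x = ∼-refl
    g-inj zero (suc v) x = ∼-trans 0∼w (inj x)
    g-inj (suc u) zero x = ∼-trans (inj x) (∼-sym 0∼w)
    g-inj (suc u) (suc v) x = inj x
  ... | c , f , wd , inj , sur | no ¬0∼ = suc c , g , (λ {u} {v} → g-wd u v) , (λ {u} {v} → g-inj u v) , g-sur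
    where
    open IsDecEquivalence eq renaming (refl to ∼-refl; sym to ∼-sym; trans to ∼-trans)
    g : Fin (suc n) → Fin (suc c)
    g zero = zero
    g (suc u) = suc (f u)
    g-wd : ∀ u v → u ∼ v → g u ≡ g v
    g-wd zero zero x = refl
    g-wd zero (suc v) x = contradiction (v , x) ¬0∼
    g-wd (suc u) zero x = contradiction (u , ∼-sym x) ¬0∼
    g-wd (suc u) (suc v) x = cong suc (wd x)
    g-inj : ∀ u v → g u ≡ g v → u ∼ v
    g-inj zero zero x = ∼-refl
    g-inj (suc u) (suc v) x = inj (sucᶠ-injective x)
    g-sur : ∀ y → ∃[ u ] g u ≡ y
    g-sur zero = zero , refl
    g-sur (suc y) = suc (proj₁ (sur y)) , cong suc (proj₂ (sur y))

  classes-≤ : ∀ {_∼_ : Rel (Fin n) 0ℓ} {c d} → Classes _∼_ c → Classes _∼_ d → c ℕ.≤ d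
  classes-≤ (f , wd , inj , sur) (g , wd′ , inj′ , sur′) =
    injective⇒≤ {f = λ y → g (proj₁ (sur y))}
      (λ {x} {y} eq → ≡.trans (≡.sym (proj₂ (sur x))) (≡.trans (wd (inj′ eq)) (proj₂ (sur y))))

quotientSetoid : {_∼_ : Rel (Fin n) 0ℓ} → IsDecEquivalence _∼_ → Setoid 0ℓ 0ℓ
quotientSetoid eq = record { isEquivalence = IsDecEquivalence.isEquivalence eq }

module _ {_∼_ : Rel (Fin n) 0ℓ} (eq : IsDecEquivalence _∼_) where

  HasClasses : ℕ → Set
  HasClasses k = Bijection (quotientSetoid eq) (finSetoid k)

  hasClasses? : ∀ k → Dec (HasClasses k)
  hasClasses? k with classes eq
  ... | c , cl with c ℕₚ.≟ k
  ...   | yes refl = yes (fromClasses cl)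
    where
    fromClasses : Classes _∼_ k → HasClasses k
    fromClasses (f , wd , inj , sur) = record
      { to = f ; cong = wd
      ; bijective = inj , λ y → proj₁ (sur y) , λ z∼ → ≡.trans (wd z∼) (proj₂ (sur y)) }
  ...   | no c≢k = no λ b → c≢k (ℕₚ.≤-antisym (classes-≤ cl (toClasses b)) (classes-≤ (toClasses b) cl))
    where
    toClasses : HasClasses k → Classes _∼_ k
    toClasses b = B.to , B.cong , B.injective ,
      λ y → proj₁ (B.surjective y) , proj₂ (B.surjective y) (IsDecEquivalence.refl eq)
      where module B = Bijection b

≡-isDecEquivalence : IsDecEquivalence (_≡_ {A = Fin n})
≡-isDecEquivalence = record { isEquivalence = ≡.isEquivalence ; _≟_ = _≟ᶠ_ }

record SimpleGraph (n m : ℕ) : Set where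
  field
    src tgt : Fin m → Fin n

  multigraph : Multigraph n m
  multigraph = record { isDecEquivalence = ≡-isDecEquivalence ; src = src ; tgt = tgt }

  field
    noLoops    : ∀ e → src e ≢ tgt e
    noParallel : ∀ {e f u v} → Joins multigraph e u v → Joins multigraph f u v → e ≡ f
    connected  : Connected multigraph ⊤

-- The boundary M is the union of the superports; (node i) is the i-th element
-- of N, and (portOf i) is the index of the superport containing it.
record Superports (n p q : ℕ) : Set where
  field
    boundary-nonempty : NonZero p
    superport         : Fin p → Subset n
    disjoint          : ∀ {a b v} → v ∈ superport a → v ∈ superport b → a ≡ b
    root              : Fin p → Fin n
    root∈             : ∀ a → root a ∈ superport a
    node              : Fin q → Fin n
    portOf            : Fin q → Fin p
    node∈             : ∀ i → node i ∈ superport (portOf i)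
    node≢root         : ∀ i → node i ≢ root (portOf i)
    node-injective    : ∀ {i j} → node i ≡ node j → i ≡ j
    node-exhaustive   : ∀ {a v} → v ∈ superport a → v ≢ root a → ∃[ i ] node i ≡ v

  rootOf : Fin q → Fin n
  rootOf i = root (portOf i)

  infix 4 _≃_
  _≃_ : Rel (Fin n) 0ℓ
  u ≃ v = u ≡ v ⊎ (∃[ a ] u ∈ superport a × v ∈ superport a)

  ≃-isDecEquivalence : IsDecEquivalence _≃_
  ≃-isDecEquivalence = record
    { isEquivalence = record { refl = inj₁ refl ; sym = ≃-sym ; trans = ≃-trans }
    ; _≟_ = λ u v → (u ≟ᶠ v) ⊎-dec any? λ a → (u ∈? superport a) ×-dec (v ∈? superport a)
    }
    where
    ≃-sym : ∀ {u v} → u ≃ v → v ≃ u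
    ≃-sym (inj₁ u≡v) = inj₁ (≡.sym u≡v)
    ≃-sym (inj₂ (a , u∈ , v∈)) = inj₂ (a , v∈ , u∈)
    ≃-trans : ∀ {u v w} → u ≃ v → v ≃ w → u ≃ w
    ≃-trans (inj₁ refl) y = y
    ≃-trans (inj₂ x) (inj₁ refl) = inj₂ x
    ≃-trans (inj₂ (a , u∈ , v∈)) (inj₂ (b , v∈′ , w∈)) with refl ← disjoint v∈ v∈′ =
      inj₂ (a , u∈ , w∈)

module _ (G : SimpleGraph n m) (S : Superports n p q) where
  open SimpleGraph G
  open Superports S

  IsForest : Subset m → Set
  IsForest = Acyclic multigraph

  HasComponents : ℕ → Subset m → Set
  HasComponents k F = HasClasses (linked-isDecEquivalence multigraph F) k

  quotientNetwork : Multigraph n m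
  quotientNetwork = record { isDecEquivalence = ≃-isDecEquivalence ; src = src ; tgt = tgt }

  IsValid : Subset m → Set
  IsValid F = IsForest F × IsSpanningTree quotientNetwork F

  quotientPortGraph : Subset m → Multigraph n q
  quotientPortGraph F = record
    { isDecEquivalence = linked-isDecEquivalence multigraph F
    ; src              = rootOf
    ; tgt              = node
    }

  isValid? : ∀ F → Dec (IsValid F)
  isValid? F = acyclic? multigraph F ×-dec isSpanningTree? quotientNetwork F

  -- The index set of the sum Ψ_I for nonempty I.
  Contributes : Subset q → Subset m → Set
  Contributes I F =
    IsForest F ×
    HasComponents (q ∸ ∣ I ∣ ℕ.+ 1) F ×
    IsSpanningTree (quotientPortGraph F) (∁ I)

  contributes? : ∀ I F → Dec (Contributes I F)
  contributes? I F =
    acyclic? multigraph F ×-dec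
    hasClasses? (linked-isDecEquivalence multigraph F) (q ∸ ∣ I ∣ ℕ.+ 1) ×-dec
    isSpanningTree? (quotientPortGraph F) (∁ I)

-- Enumerates I in increasing order, so that submatrices inherit the order.
element : (I : Subset n) → Fin ∣ I ∣ → Fin n
element (inside  Vec.∷ I) zero    = zero
element (inside  Vec.∷ I) (suc i) = suc (element I i)
element (outside Vec.∷ I) i       = suc (element I i)

module _ {c ℓ₁ ℓ₂} (K : OrderedField c ℓ₁ ℓ₂) where
  open OrderedField K hiding (zero)

  Matrix : ℕ → ℕ → Set c
  Matrix r s = Fin r → Fin s → Carrier

  infixl 7 _·_
  _·_ : ∀ {r s} → Matrix r s → Vector Carrier s → Vector Carrier r
  (A · x) i = ∑ λ j → A i j * x j

  submatrix : ∀ {r s} → Matrix r s → (S : Subset r) (T : Subset s) → Matrix ∣ S ∣ ∣ T ∣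
  submatrix A S T i j = A (element S i) (element T j)

  sign : ℕ → Carrier
  sign zero    = 1#
  sign (suc k) = - sign k

  det : Matrix n n → Carrier
  det {zero}  A = 1#
  det {suc n} A = ∑ λ j → sign (toℕ j) * A zero j * det (λ i k → A (suc i) (punchIn j k))

  ∑Subsets : (Subset m → Carrier) → Carrier
  ∑Subsets {zero}  f = f Vec.[]
  ∑Subsets {suc m} f = ∑Subsets (λ F → f (outside Vec.∷ F)) + ∑Subsets (λ F → f (inside Vec.∷ F))

  ∑Subsets[_] : {P : Subset m → Set} → (∀ F → Dec (P F)) → (Subset m → Carrier) → Carrier
  ∑Subsets[ P? ] f = ∑Subsets λ F → if does (P? F) then f F else 0#

  module _ (G : SimpleGraph n m) (cond : Fin m → Carrier) where
    open SimpleGraph G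

    laplacian : Matrix n n
    laplacian u v with u ≟ᶠ v
    ... | yes _ = ∑ λ e → if does ((src e ≟ᶠ u) ⊎-dec (tgt e ≟ᶠ u)) then cond e else 0#
    ... | no  _ with any? (λ e → joins? multigraph e u v)
    ...   | yes (e , _) = - cond e
    ...   | no  _       = 0#

    weight : Subset m → Carrier
    weight F = ∏ λ e → if does (e ∈? F) then cond e else 1#

    module _ (S : Superports n p q) where
      open Superports S

      record Admissible (y : Vector Carrier q) (U : Vector Carrier n) : Set ℓ₁ where
        ι : Vector Carrier n
        ι = laplacian · U
        field
          port-voltages   : ∀ i → U (node i) - U (rootOf i) ≈ y i
          interior-free   : ∀ v → (∀ a → v ∉ superport a) → ι v ≈ 0#
          current-neutral : ∀ a → ∑ (λ v → if does (v ∈? superport a) then ι v else 0#) ≈ 0#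

      -- L is the matrix of the map y ↦ j: every y has admissible voltages, and
      -- all of them have the currents j = L y.
      IsResponseMatrix : Matrix q q → Set (c ⊔ ℓ₁)
      IsResponseMatrix L = ∀ y →
        (∃[ U ] Admissible y U) ×
        (∀ U → Admissible y U → ∀ i → (laplacian · U) (node i) ≈ (L · y) i)

      Φ-valid : Carrier
      Φ-valid = ∑Subsets[ isValid? G S ] weight

      Ψ : Subset q → Carrier
      Ψ I = if does (nonempty? I) then ∑Subsets[ contributes? G S I ] weight else Φ-valid

{-# OPTIONS --safe #-}

-- For I ⊆ N contract the ports outside I and label the resulting vertices.
-- Adding an edge changes the reduced Laplacian ∑ₑ cₑ bₑ bₑᵀ by a matrix of rank
-- one, so its determinant obeys deletion–contraction and equals the weighted
-- number of spanning trees of the contracted network.  These trees are the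
-- forests of Ψ_I: F ∪ (N ∖ I) is a spanning tree of the network with port edges,
-- whichever of the two sets is contracted first.  In the coordinates (y , z) of
-- the superport problem the row operations given by the admissible voltages of
-- the unit vectors bring the reduced Laplacian to block triangular form with
-- diagonal blocks L[I,I]ᵀ and the reduced Laplacian of I = ∅, whose determinant
-- is Φ_valid.
module Submission where

open import Defs
open import Algebra.Bundles using (CommutativeRing)
import Algebra.Properties.CommutativeSemigroup as CommutativeSemigroupProperties
import Algebra.Properties.Ring as RingProperties
import Algebra.Properties.Semiring.Sum as SemiringSum
open import Data.Bool.Base using (true; false; if_then_else_)
open import Data.Fin.Base using (Fin; zero; suc; toℕ; fromℕ; fromℕ<; inject₁; punchIn; _↑ˡ_; _↑ʳ_; splitAt)
open import Data.Fin.Induction using (<-weakInduction)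
open import Data.Fin.Properties
  using (any?; fromℕ≢inject₁; inject₁-injective; toℕ-↑ˡ; ↑ˡ-injective; ↑ʳ-injective;
         splitAt-↑ˡ; splitAt-↑ʳ; splitAt⁻¹-↑ˡ; splitAt⁻¹-↑ʳ)
  renaming (_≟_ to _≟ᶠ_; suc-injective to sucᶠ-injective)
open import Data.Fin.Subset using (Subset; Nonempty; inside; outside; _∈_; _∉_; ⊤; ∁; ∣_∣)
open import Data.Fin.Subset.Properties using (_∈?_; nonempty?; ∈⊤; x∉p⇒x∈∁p; x∈∁p⇒x∉p; ∣∁p∣≡n∸∣p∣)
open import Data.Nat.Base as ℕ using (ℕ; zero; suc; _∸_) renaming (_+_ to _+ᴺ_)
import Data.Nat.Properties as ℕₚ
open import Data.Product.Base using (∃; ∃-syntax; Σ-syntax; _×_; _,_; proj₁; proj₂)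
open import Data.Sum.Base using (_⊎_; inj₁; inj₂)
open import Data.Unit.Base using (tt) renaming (⊤ to Unit)
open import Data.Vec.Base as Vec using (here; there; _[_]≔_)
open import Data.Vec.Functional using (Vector; []; _∷_; _++_; replicate; updateAt)
open import Data.Vec.Functional.Properties
  using (updateAt-updates; updateAt-minimal; updateAt-id-local; lookup-++ˡ; lookup-++ʳ)
open import Data.Vec.Properties using ([]≔-minimal; []≔-updates; []=-injective)
open import Function.Base using (_∘_; const; id; case_of_)
open import Function.Bundles using (_⇔_; mk⇔; Equivalence)
open import Level using (0ℓ; _⊔_)
open import Relation.Binary.Construct.Closure.ReflexiveTransitive using (ε; _◅_; _◅◅_)
open import Relation.Binary.Core using (Rel; _⇒_)
open import Relation.Binary.Definitions using (Decidable)
open import Relation.Binary.PropositionalEquality as ≡ using (_≡_; _≢_)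
import Relation.Binary.Reasoning.Setoid as SetoidReasoning
open import Relation.Binary.Structures using (IsEquivalence; IsDecEquivalence; IsStrictPartialOrder)
open import Relation.Nullary.Decidable using (Dec; yes; no; does; dec-true; dec-false; _⊎-dec_; _×-dec_)
open import Relation.Nullary.Negation using (¬_; contradiction)

-- The hypothesis describes `L` only by what it does to voltages, so the elimination inverts no
-- block: the admissible voltages themselves supply the row multipliers. The identity is proved
-- without division, as Ψ_I = det L[I,I] · Φ_valid; that Φ_valid is apart from 0 comes separately,
-- from positivity of the weights and the existence of a valid forest. Cycles are awkward for an
-- induction over edges. Acyclicity is therefore replaced by a recursion over the edge list in which
-- every chosen edge must join two classes that are still different. Contracting the first edge is
-- then definitional, and independence of the order is an exchange property. Matrices need
-- coordinates on the classes. These are labels in `Fin (suc r)` with 0 as ground. Once an edge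
-- joins the labels 0 and 1, adding it changes one corner entry and contracting it deletes the first
-- row and column.

private variable
  n m q r ℓ : ℕ

-- Contraction and independence of edge sets

-- A walk that uses the new pair twice can be shortened, so for an equivalence `∼` these three cases
-- are already transitive. This closed form keeps the relation decidable without a search.
Merge : Rel (Fin n) 0ℓ → Fin n → Fin n → Rel (Fin n) 0ℓ
Merge _∼_ s t u v = u ∼ v ⊎ (u ∼ s × t ∼ v) ⊎ (u ∼ t × s ∼ v)

Close : Rel (Fin n) 0ℓ → (s t : Fin m → Fin n) → Subset m → Rel (Fin n) 0ℓ
Close _∼_ s t Vec.[]              = _∼_
Close _∼_ s t (outside Vec.∷ F)   = Close _∼_ (s ∘ suc) (t ∘ suc) F
Close _∼_ s t (inside  Vec.∷ F)   = Close (Merge _∼_ (s zero) (t zero)) (s ∘ suc) (t ∘ suc) F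

-- Acyclicity as a greedy algorithm sees it: in order of index, each edge of the set must join
-- classes not yet merged by the earlier ones. Deletion and contraction of the first edge hold by
-- definition.
Independent : Rel (Fin n) 0ℓ → (s t : Fin m → Fin n) → Subset m → Set
Independent _∼_ s t Vec.[]            = Unit
Independent _∼_ s t (outside Vec.∷ F) = Independent _∼_ (s ∘ suc) (t ∘ suc) F
Independent _∼_ s t (inside  Vec.∷ F) =
  ¬ (s zero ∼ t zero) × Independent (Merge _∼_ (s zero) (t zero)) (s ∘ suc) (t ∘ suc) F

Total : Rel (Fin n) 0ℓ → Set
Total _∼_ = ∀ u v → u ∼ v

Tree : Rel (Fin n) 0ℓ → (s t : Fin m → Fin n) → Subset m → Set
Tree _∼_ s t F = Independent _∼_ s t F × Total (Close _∼_ s t F)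

module _ {_∼_ : Rel (Fin n) 0ℓ} (eq : IsEquivalence _∼_) where
  open IsEquivalence eq

  merge-isEquivalence : ∀ s t → IsEquivalence (Merge _∼_ s t)
  merge-isEquivalence s t = record
    { refl  = inj₁ refl
    ; sym   = λ where
        (inj₁ a)              → inj₁ (sym a)
        (inj₂ (inj₁ (a , b))) → inj₂ (inj₂ (sym b , sym a))
        (inj₂ (inj₂ (a , b))) → inj₂ (inj₁ (sym b , sym a))
    ; trans = λ where
        (inj₁ a)              (inj₁ b)              → inj₁ (trans a b)
        (inj₁ a)              (inj₂ (inj₁ (b , c))) → inj₂ (inj₁ (trans a b , c))
        (inj₁ a)              (inj₂ (inj₂ (b , c))) → inj₂ (inj₂ (trans a b , c))
        (inj₂ (inj₁ (a , b))) (inj₁ c)              → inj₂ (inj₁ (a , trans b c))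
        (inj₂ (inj₁ (a , b))) (inj₂ (inj₁ (c , d))) → inj₂ (inj₁ (a , d))
        (inj₂ (inj₁ (a , b))) (inj₂ (inj₂ (c , d))) → inj₁ (trans a d)
        (inj₂ (inj₂ (a , b))) (inj₁ c)              → inj₂ (inj₂ (a , trans b c))
        (inj₂ (inj₂ (a , b))) (inj₂ (inj₁ (c , d))) → inj₁ (trans a d)
        (inj₂ (inj₂ (a , b))) (inj₂ (inj₂ (c , d))) → inj₂ (inj₂ (a , d))
    }

  merge-edge : ∀ s t → Merge _∼_ s t s t
  merge-edge s t = inj₂ (inj₁ (refl , refl))

  merge-least : ∀ {_∼′_ : Rel (Fin n) 0ℓ} {s t} → _∼′_ ⇒ _∼_ → s ∼ t → Merge _∼′_ s t ⇒ _∼_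
  merge-least ι s∼t (inj₁ a)              = ι a
  merge-least ι s∼t (inj₂ (inj₁ (a , b))) = trans (ι a) (trans s∼t (ι b))
  merge-least ι s∼t (inj₂ (inj₂ (a , b))) = trans (ι a) (trans (sym s∼t) (ι b))

  -- Both sides say that the two pairs together are independent. A connection of `s` and `t` through
  -- the pair `s′ t′` reads backwards as a connection of `s′` and `t′` through `s t`.
  exchange : ∀ {s t s′ t′} → ¬ (s ∼ t) → ¬ Merge _∼_ s t s′ t′ → ¬ Merge _∼_ s′ t′ s t
  exchange s≁t _ (inj₁ a)              = s≁t a
  exchange _   ¬m (inj₂ (inj₁ (a , b))) = ¬m (inj₂ (inj₁ (sym a , sym b)))
  exchange _   ¬m (inj₂ (inj₂ (a , b))) = ¬m (inj₂ (inj₂ (b , a)))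

merge-mono : ∀ {_∼_ _≈_ : Rel (Fin n) 0ℓ} {s t} → _∼_ ⇒ _≈_ → Merge _∼_ s t ⇒ Merge _≈_ s t
merge-mono ι (inj₁ a)              = inj₁ (ι a)
merge-mono ι (inj₂ (inj₁ (a , b))) = inj₂ (inj₁ (ι a , ι b))
merge-mono ι (inj₂ (inj₂ (a , b))) = inj₂ (inj₂ (ι a , ι b))

merge-comm : ∀ {_∼_ : Rel (Fin n) 0ℓ} → IsEquivalence _∼_ → ∀ {s t s′ t′} →
             Merge (Merge _∼_ s t) s′ t′ ⇒ Merge (Merge _∼_ s′ t′) s t
merge-comm eq {s} {t} {s′} {t′} = merge-least eq″
  (merge-least eq″ (inj₁ ∘ inj₁) (merge-edge eq′ s t)) (inj₁ (merge-edge eq s′ t′))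
  where
  eq′ = merge-isEquivalence eq s′ t′
  eq″ = merge-isEquivalence eq′ s t

close-isEquivalence : ∀ {_∼_ : Rel (Fin n) 0ℓ} → IsEquivalence _∼_ →
                      ∀ (s t : Fin m → Fin n) F → IsEquivalence (Close _∼_ s t F)
close-isEquivalence eq s t Vec.[]            = eq
close-isEquivalence eq s t (outside Vec.∷ F) = close-isEquivalence eq _ _ F
close-isEquivalence eq s t (inside  Vec.∷ F) = close-isEquivalence (merge-isEquivalence eq _ _) _ _ F

close-mono : ∀ {_∼_ _≈_ : Rel (Fin n) 0ℓ} → _∼_ ⇒ _≈_ →
             ∀ (s t : Fin m → Fin n) F → Close _∼_ s t F ⇒ Close _≈_ s t F
close-mono ι s t Vec.[]            = ι
close-mono ι s t (outside Vec.∷ F) = close-mono ι _ _ F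
close-mono {_∼_ = _∼_} {_≈_} ι s t (inside Vec.∷ F) = close-mono (merge-mono {_∼_ = _∼_} {_≈_} ι) _ _ F

close-⊇ : ∀ {_∼_ : Rel (Fin n) 0ℓ} (s t : Fin m → Fin n) F → _∼_ ⇒ Close _∼_ s t F
close-⊇ s t Vec.[]            = id
close-⊇ s t (outside Vec.∷ F) = close-⊇ _ _ F
close-⊇ s t (inside  Vec.∷ F) = close-⊇ _ _ F ∘ inj₁

close-edge : ∀ {_∼_ : Rel (Fin n) 0ℓ} → IsEquivalence _∼_ →
             ∀ (s t : Fin m → Fin n) {F e} → e ∈ F → Close _∼_ s t F (s e) (t e)
close-edge eq s t {inside  Vec.∷ F} here        = close-⊇ _ _ F (merge-edge eq _ _)
close-edge eq s t {inside  Vec.∷ F} (there e∈F) = close-edge (merge-isEquivalence eq _ _) _ _ e∈F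
close-edge eq s t {outside Vec.∷ F} (there e∈F) = close-edge eq _ _ e∈F

-- With `close-⊇` and `close-edge` this is the universal property of the equivalence generated by
-- `F`; comparisons of contractions use it in place of inductions over walks.
close-least : ∀ {_∼_ _≈_ : Rel (Fin n) 0ℓ} → IsEquivalence _≈_ → _∼_ ⇒ _≈_ →
              ∀ (s t : Fin m → Fin n) F → (∀ {e} → e ∈ F → s e ≈ t e) → Close _∼_ s t F ⇒ _≈_
close-least eq ι s t Vec.[]            edge = ι
close-least eq ι s t (outside Vec.∷ F) edge = close-least eq ι _ _ F (edge ∘ there)
close-least eq ι s t (inside  Vec.∷ F) edge = close-least eq (merge-least eq ι (edge here)) _ _ F (edge ∘ there)

close-comm : ∀ {_∼_ : Rel (Fin n) 0ℓ} → IsEquivalence _∼_ →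
             ∀ (s t : Fin m → Fin n) F (s′ t′ : Fin q → Fin n) J →
             Close (Close _∼_ s t F) s′ t′ J ⇒ Close (Close _∼_ s′ t′ J) s t F
close-comm eq s t F s′ t′ J = close-least (close-isEquivalence eqJ s t F)
  (close-mono (close-⊇ s′ t′ J) s t F) s′ t′ J (close-⊇ s t F ∘ close-edge eq s′ t′)
  where eqJ = close-isEquivalence eq s′ t′ J

merge? : ∀ {_∼_ : Rel (Fin n) 0ℓ} → Decidable _∼_ → ∀ s t → Decidable (Merge _∼_ s t)
merge? ∼? s t u v = ∼? u v ⊎-dec (∼? u s ×-dec ∼? t v) ⊎-dec (∼? u t ×-dec ∼? s v)

independent-anti : ∀ {_∼_ _≈_ : Rel (Fin n) 0ℓ} → _∼_ ⇒ _≈_ →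
                   ∀ (s t : Fin m → Fin n) F → Independent _≈_ s t F → Independent _∼_ s t F
independent-anti ι s t Vec.[]            _         = tt
independent-anti ι s t (outside Vec.∷ F) i         = independent-anti ι _ _ F i
independent-anti {_∼_ = _∼_} {_≈_} ι s t (inside Vec.∷ F) (s≉t , i) =
  s≉t ∘ ι , independent-anti (merge-mono {_∼_ = _∼_} {_≈_} ι) _ _ F i

tree-resp : ∀ {_∼_ _≈_ : Rel (Fin n) 0ℓ} → _∼_ ⇒ _≈_ → _≈_ ⇒ _∼_ →
            ∀ (s t : Fin m → Fin n) F → Tree _∼_ s t F → Tree _≈_ s t F
tree-resp ι κ s t F (i , tot) = independent-anti κ s t F i , λ u v → close-mono ι s t F (tot u v)

-- If `F` linked `u` and `v`, the extra pair would close a cycle. The induction carries the pair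
-- past the first edge of `F`, where `exchange` restores its hypothesis.
independent-merge : ∀ {_∼_ : Rel (Fin n) 0ℓ} → IsEquivalence _∼_ → ∀ {u v} → ¬ (u ∼ v) →
  ∀ (s t : Fin m → Fin n) F → Independent (Merge _∼_ u v) s t F → ¬ Close _∼_ s t F u v
independent-merge eq u≁v s t Vec.[]            _        = u≁v
independent-merge eq u≁v s t (outside Vec.∷ F) i        = independent-merge eq u≁v _ _ F i
independent-merge eq u≁v s t (inside  Vec.∷ F) (¬m , i) =
  independent-merge (merge-isEquivalence eq _ _) (exchange eq u≁v ¬m) _ _ F
    (independent-anti (merge-comm eq) _ _ F i)

-- Both sides express independence of the union of `J` and `F`. The first edge of `J` is moved
-- behind `F`, and `independent-merge` shows that its ends are still apart there.
independent-comm : ∀ {_∼_ : Rel (Fin n) 0ℓ} → IsEquivalence _∼_ →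
  ∀ (s t : Fin m → Fin n) F (s′ t′ : Fin q → Fin n) J →
  Independent _∼_ s′ t′ J → Independent (Close _∼_ s′ t′ J) s t F →
  Independent _∼_ s t F × Independent (Close _∼_ s t F) s′ t′ J
independent-comm eq s t F s′ t′ Vec.[]            _         i = i , tt
independent-comm eq s t F s′ t′ (outside Vec.∷ J) j         i = independent-comm eq s t F _ _ J j i
independent-comm eq s t F s′ t′ (inside  Vec.∷ J) (s≁t , j) i
  with i′ , j′ ← independent-comm (merge-isEquivalence eq _ _) s t F _ _ J j i =
  independent-anti inj₁ s t F i′ ,
  independent-merge eq s≁t s t F i′ ,
  independent-anti (merge-least (close-isEquivalence (merge-isEquivalence eq _ _) s t F)
    (close-mono inj₁ s t F) (close-⊇ s t F (merge-edge eq _ _))) _ _ J j′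

-- With its converse below, this removes the order of the edges from `Independent`: no edge of the
-- set may have its ends linked by the others. In this form it can be compared with cycles.
independent⇒no-bypass : ∀ {_∼_ : Rel (Fin n) 0ℓ} → IsEquivalence _∼_ → ∀ (s t : Fin m → Fin n) F →
  Independent _∼_ s t F → ∀ {e} → e ∈ F → ¬ Close _∼_ s t (F [ e ]≔ outside) (s e) (t e)
independent⇒no-bypass eq s t (inside  Vec.∷ F) (s≁t , i) here        = independent-merge eq s≁t _ _ F i
independent⇒no-bypass eq s t (inside  Vec.∷ F) (s≁t , i) (there e∈F) =
  independent⇒no-bypass (merge-isEquivalence eq _ _) _ _ F i e∈F
independent⇒no-bypass eq s t (outside Vec.∷ F) i         (there e∈F) = independent⇒no-bypass eq _ _ F i e∈F

no-bypass⇒independent : ∀ {_∼_ : Rel (Fin n) 0ℓ} (s t : Fin m → Fin n) F →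
  (∀ {e} → e ∈ F → ¬ Close _∼_ s t (F [ e ]≔ outside) (s e) (t e)) → Independent _∼_ s t F
no-bypass⇒independent s t Vec.[]            _  = tt
no-bypass⇒independent s t (outside Vec.∷ F) ¬b = no-bypass⇒independent _ _ F (¬b ∘ there)
no-bypass⇒independent s t (inside  Vec.∷ F) ¬b =
  ¬b here ∘ close-⊇ _ _ F , no-bypass⇒independent _ _ F (¬b ∘ there)

-- Greedy choice: an edge is kept exactly when its ends are still apart. Applied to the quotient
-- network, it yields a valid forest.
spanning-tree : ∀ {_∼_ : Rel (Fin n) 0ℓ} → IsEquivalence _∼_ → Decidable _∼_ →
  ∀ (s t : Fin m → Fin n) → Total (Close _∼_ s t ⊤) → ∃ (Tree _∼_ s t)
spanning-tree {m = zero}  eq ∼? s t tot = Vec.[] , tt , tot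
spanning-tree {m = suc m} {_∼_} eq ∼? s t tot with ∼? (s zero) (t zero)
... | yes s∼t with F , T ← spanning-tree eq ∼? (s ∘ suc) (t ∘ suc)
                             (λ u v → close-mono (merge-least eq {_∼_} id s∼t) (s ∘ suc) (t ∘ suc) (⊤ {m}) (tot u v)) =
  outside Vec.∷ F , T
... | no  s≁t with F , i , T ← spanning-tree (merge-isEquivalence eq (s zero) (t zero))
                                 (merge? ∼? _ _) (s ∘ suc) (t ∘ suc) tot =
  inside Vec.∷ F , (s≁t , i) , T

-- Cycles of a multigraph

module _ (H : Multigraph n m) where
  open Multigraph H

  linked-isEquivalence : ∀ T → IsEquivalence (Linked H T)
  linked-isEquivalence T = IsDecEquivalence.isEquivalence (linked-isDecEquivalence H T)

  linked⇒close : ∀ T → Linked H T ⇒ Close _∼_ src tgt T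
  linked⇒close T ε = IsEquivalence.refl (close-isEquivalence isEquivalence src tgt T)
  linked⇒close T (step ◅ l) = IsEquivalence.trans eqT (fromStep step) (linked⇒close T l)
    where
    eqT = close-isEquivalence isEquivalence src tgt T
    open IsEquivalence eqT using () renaming (sym to symT; trans to transT)
    up : _∼_ ⇒ Close _∼_ src tgt T
    up = close-⊇ src tgt T
    fromStep : Step H T ⇒ Close _∼_ src tgt T
    fromStep (inj₁ u∼v) = up u∼v
    fromStep (inj₂ (e , e∈T , inj₁ (a , b))) = transT (symT (up a)) (transT (close-edge isEquivalence src tgt e∈T) (up b))
    fromStep (inj₂ (e , e∈T , inj₂ (a , b))) = transT (symT (up b)) (transT (symT (close-edge isEquivalence src tgt e∈T)) (up a))

  close⇒linked : ∀ T → Close _∼_ src tgt T ⇒ Linked H T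
  close⇒linked T = close-least (linked-isEquivalence T) (λ u∼v → inj₁ u∼v ◅ ε) src tgt T
    λ {e} e∈T → inj₂ (e , e∈T , inj₁ (∼-refl , ∼-refl)) ◅ ε

  joins⇒linked : ∀ {T e u v} → Joins H e u v → Linked H T v u → Linked H T (src e) (tgt e)
  joins⇒linked (inj₁ (a , b)) l = inj₁ a ◅ (linked-sym l ◅◅ inj₁ (∼-sym b) ◅ ε)
    where linked-sym = IsEquivalence.sym (linked-isEquivalence _)
  joins⇒linked (inj₂ (a , b)) l = inj₁ a ◅ (l ◅◅ inj₁ (∼-sym b) ◅ ε)

  walk⇒linked : ∀ {T} (v : Vector (Fin n) (suc ℓ)) (e : Vector (Fin m) ℓ) → (∀ i → e i ∈ T) →
    (∀ i → Joins H (e i) (v (inject₁ i)) (v (suc i))) → Linked H T (v zero) (v (fromℕ ℓ))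
  walk⇒linked {ℓ = zero}  v e e∈T joins = ε
  walk⇒linked {ℓ = suc ℓ} v e e∈T joins =
    inj₂ (e zero , e∈T zero , joins zero) ◅ walk⇒linked (v ∘ suc) (e ∘ suc) (e∈T ∘ suc) (joins ∘ suc)

  module SimplePath (T : Subset m) where

    -- Moves inside a class, which `Linked` counts as steps, are absorbed by the slack in `Joins`
    -- and in `nil`, so that the length counts edges only, as `IsCycle` does.
    data Path : Rel (Fin n) 0ℓ where
      nil  : ∀ {u v} → u ∼ v → Path u v
      cons : ∀ {u w v} e → e ∈ T → Joins H e u w → Path w v → Path u v

    On : ∀ {u v} → Fin n → Path u v → Set
    On x (nil {u} _)          = x ∼ u
    On x (cons {u} _ _ _ p)   = x ∼ u ⊎ On x p

    Simple : ∀ {u v} → Path u v → Set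
    Simple (nil _)              = Unit
    Simple (cons {u} _ _ _ p)   = ¬ On u p × Simple p

    on? : ∀ {u v} x (p : Path u v) → Dec (On x p)
    on? x (nil {u} _)        = x ∼? u
    on? x (cons {u} _ _ _ p) = (x ∼? u) ⊎-dec on? x p

    on-resp : ∀ {u v x y} (p : Path u v) → x ∼ y → On x p → On y p
    on-resp (nil _)        x∼y o        = ∼-trans (∼-sym x∼y) o
    on-resp (cons _ _ _ p) x∼y (inj₁ o) = inj₁ (∼-trans (∼-sym x∼y) o)
    on-resp (cons _ _ _ p) x∼y (inj₂ o) = inj₂ (on-resp p x∼y o)

    on-start : ∀ {u v} (p : Path u v) → On u p
    on-start (nil _)        = ∼-refl
    on-start (cons _ _ _ p) = inj₁ ∼-refl

    joins-resp : ∀ {e u u′ v} → u′ ∼ u → Joins H e u v → Joins H e u′ v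
    joins-resp u′∼u (inj₁ (a , b)) = inj₁ (∼-trans a (∼-sym u′∼u) , b)
    joins-resp u′∼u (inj₂ (a , b)) = inj₂ (a , ∼-trans b (∼-sym u′∼u))

    suffix : ∀ {u v x} (p : Path u v) → Simple p → On x p → Σ[ p′ ∈ Path x v ] Simple p′
    suffix (nil u∼v)         _        o        = nil (∼-trans o u∼v) , tt
    suffix (cons e e∈T j p) (¬o , s) (inj₁ o) = cons e e∈T (joins-resp o j) p , ¬o ∘ on-resp p o , s
    suffix (cons e e∈T j p) (¬o , s) (inj₂ o) = suffix p s o

    -- Loop erasure: if the new start already lies on the simplified rest, only the part from that
    -- visit on is kept.
    simplify : ∀ {u v} → Linked H T u v → Σ[ p ∈ Path u v ] Simple p
    simplify ε = nil ∼-refl , tt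
    simplify (inj₁ u∼w ◅ l) with p , s ← simplify l = suffix p s (on-resp p (∼-sym u∼w) (on-start p))
    simplify {u} (inj₂ (e , e∈T , j) ◅ l) with p , s ← simplify l with on? u p
    ... | yes o = suffix p s o
    ... | no ¬o = cons e e∈T j p , ¬o , s

    length : ∀ {u v} → Path u v → ℕ
    length (nil _)        = zero
    length (cons _ _ _ p) = suc (length p)

    vertex : ∀ {u v} (p : Path u v) → Vector (Fin n) (suc (length p))
    vertex (nil {u} _)        = λ _ → u
    vertex (cons {u} _ _ _ p) = u ∷ vertex p

    edge : ∀ {u v} (p : Path u v) → Vector (Fin m) (length p)
    edge (cons e _ _ p) = e ∷ edge p

    vertex-first : ∀ {u v} (p : Path u v) → vertex p zero ≡ u
    vertex-first (nil _)        = ≡.refl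
    vertex-first (cons _ _ _ p) = ≡.refl

    vertex-last : ∀ {u v} (p : Path u v) → vertex p (fromℕ (length p)) ∼ v
    vertex-last (nil u∼v)      = u∼v
    vertex-last (cons _ _ _ p) = vertex-last p

    edge∈ : ∀ {u v} (p : Path u v) i → edge p i ∈ T
    edge∈ (cons _ e∈T _ _) zero    = e∈T
    edge∈ (cons _ _   _ p) (suc i) = edge∈ p i

    edge-joins : ∀ {u v} (p : Path u v) i → Joins H (edge p i) (vertex p (inject₁ i)) (vertex p (suc i))
    edge-joins (cons e _ j p) zero    = ≡.subst (Joins H e _) (≡.sym (vertex-first p)) j
    edge-joins (cons e _ j p) (suc i) = edge-joins p i

    vertex-on : ∀ {u v} (p : Path u v) i {x} → x ∼ vertex p i → On x p
    vertex-on (nil _)        _       x∼ = x∼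
    vertex-on (cons _ _ _ p) zero    x∼ = inj₁ x∼
    vertex-on (cons _ _ _ p) (suc i) x∼ = inj₂ (vertex-on p i x∼)

    vertex-distinct : ∀ {u v} (p : Path u v) → Simple p → ∀ i j → vertex p i ∼ vertex p j → i ≡ j
    vertex-distinct (nil _)        _        zero    zero    _ = ≡.refl
    vertex-distinct (cons _ _ _ p) _        zero    zero    _ = ≡.refl
    vertex-distinct (cons _ _ _ p) (¬o , _) zero    (suc j) x = contradiction (vertex-on p j x) ¬o
    vertex-distinct (cons _ _ _ p) (¬o , _) (suc i) zero    x = contradiction (vertex-on p i (∼-sym x)) ¬o
    vertex-distinct (cons _ _ _ p) (_ , s)  (suc i) (suc j) x = ≡.cong suc (vertex-distinct p s i j x)

    joins-on : ∀ {u v x y} (p : Path u v) i → Joins H (edge p i) x y → On x p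
    joins-on p i j with edge-joins p i
    joins-on p i (inj₁ (a , _)) | inj₁ (b , _) = vertex-on p (inject₁ i) (∼-trans (∼-sym a) b)
    joins-on p i (inj₁ (a , _)) | inj₂ (b , _) = vertex-on p (suc i) (∼-trans (∼-sym a) b)
    joins-on p i (inj₂ (_ , a)) | inj₁ (_ , b) = vertex-on p (suc i) (∼-trans (∼-sym a) b)
    joins-on p i (inj₂ (_ , a)) | inj₂ (_ , b) = vertex-on p (inject₁ i) (∼-trans (∼-sym a) b)

    -- A second use of the edge leaving `u` would put `u` on the rest of the path, by `joins-on`,
    -- against simplicity.
    edge-distinct : ∀ {u v} (p : Path u v) → Simple p → ∀ i j → edge p i ≡ edge p j → i ≡ j
    edge-distinct (cons _ _ _ p) _        zero    zero    _ = ≡.refl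
    edge-distinct (cons {u} e _ j p) (¬o , _) zero    (suc i) e≡ =
      contradiction (joins-on p i (≡.subst (λ e → Joins H e u _) e≡ j)) ¬o
    edge-distinct (cons {u} e _ j p) (¬o , _) (suc i) zero    e≡ =
      contradiction (joins-on p i (≡.subst (λ e → Joins H e u _) (≡.sym e≡) j)) ¬o
    edge-distinct (cons _ _ _ p) (_ , s)  (suc i) (suc j) e≡ = ≡.cong suc (edge-distinct p s i j e≡)

  module _ (T : Subset m) where

    private
      remove-∈ : ∀ {e f} → f ∈ T → f ≢ e → f ∈ T [ e ]≔ outside
      remove-∈ {e} {f} f∈T f≢e = []≔-minimal T f e f≢e f∈T

      remove-∉ : ∀ {e} → e ∉ T [ e ]≔ outside
      remove-∉ {e} e∈ with () ← []=-injective ([]≔-updates T e) e∈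

      remove-⊆ : ∀ {m} {T : Subset m} {e f} → f ∈ T [ e ]≔ outside → f ∈ T
      remove-⊆ {T = x Vec.∷ T} {zero}  (there f∈) = there f∈
      remove-⊆ {T = x Vec.∷ T} {suc e} here       = here
      remove-⊆ {T = x Vec.∷ T} {suc e} (there f∈) = there (remove-⊆ f∈)

    -- A simple path from `tgt e` back to `src e` avoiding `e` is closed up by `e` itself. Length
    -- zero is allowed and gives a loop.
    bypass⇒cycle : ∀ {e} → e ∈ T → Linked H (T [ e ]≔ outside) (src e) (tgt e) → ¬ Acyclic H T
    bypass⇒cycle {e} e∈T l acyclic
      with p , s ← SimplePath.simplify (T [ e ]≔ outside)
                     (IsEquivalence.sym (linked-isEquivalence (T [ e ]≔ outside)) l) =
      acyclic (length p , src e ∷ vertex p , e ∷ edge p , in-T , joins , vertex-last p , edges-distinct , vertices-distinct)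
      where
      open SimplePath (T [ e ]≔ outside)
      in-T : ∀ i → (e ∷ edge p) i ∈ T
      in-T zero    = e∈T
      in-T (suc i) = remove-⊆ (edge∈ p i)
      joins : ∀ i → Joins H ((e ∷ edge p) i) ((src e ∷ vertex p) (inject₁ i)) ((src e ∷ vertex p) (suc i))
      joins zero    = ≡.subst (Joins H e (src e)) (≡.sym (vertex-first p)) (inj₁ (∼-refl , ∼-refl))
      joins (suc i) = edge-joins p i
      edges-distinct : ∀ i j → (e ∷ edge p) i ≡ (e ∷ edge p) j → i ≡ j
      edges-distinct zero    zero    _  = ≡.refl
      edges-distinct zero    (suc j) e≡ = contradiction (≡.subst (_∈ T [ e ]≔ outside) (≡.sym e≡) (edge∈ p j)) remove-∉
      edges-distinct (suc i) zero    e≡ = contradiction (≡.subst (_∈ T [ e ]≔ outside) e≡ (edge∈ p i)) remove-∉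
      edges-distinct (suc i) (suc j) e≡ = ≡.cong suc (edge-distinct p s i j e≡)
      -- The path ends in the class of `src e`, so an earlier visit to that class would repeat its
      -- last vertex.
      start-distinct : ∀ i → ¬ (src e ∼ vertex p (inject₁ i))
      start-distinct i x = fromℕ≢inject₁ (vertex-distinct p s _ _ (∼-trans (vertex-last p) x))
      vertices-distinct : ∀ i j → (src e ∷ vertex p) (inject₁ i) ∼ (src e ∷ vertex p) (inject₁ j) → i ≡ j
      vertices-distinct zero    zero    _ = ≡.refl
      vertices-distinct zero    (suc j) x = contradiction x (start-distinct j)
      vertices-distinct (suc i) zero    x = contradiction (∼-sym x) (start-distinct i)
      vertices-distinct (suc i) (suc j) x with ≡.refl ← inject₁-injective (vertex-distinct p s _ _ x) = ≡.refl

    acyclic⇒independent : Acyclic H T → Independent _∼_ src tgt T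
    acyclic⇒independent acyclic = no-bypass⇒independent src tgt T λ {e} e∈T c →
      bypass⇒cycle e∈T (close⇒linked (T [ e ]≔ outside) c) acyclic

    -- The remaining edges of a cycle bypass its first one; distinctness of the edges keeps them
    -- inside `T′`.
    independent⇒acyclic : Independent _∼_ src tgt T → Acyclic H T
    independent⇒acyclic indep (ℓ , v , e , in-T , joins , closed , e-inj , _) =
      independent⇒no-bypass isEquivalence src tgt T indep (in-T zero)
        (linked⇒close T′ (joins⇒linked (joins zero)
          (walk⇒linked (v ∘ suc) (e ∘ suc)
            (λ i → remove-∈ (in-T (suc i)) λ eq → case e-inj (suc i) zero eq of λ ())
            (joins ∘ suc) ◅◅ inj₁ closed ◅ ε)))
      where T′ = T [ e zero ]≔ outside

    isSpanningTree⇔tree : IsSpanningTree H T ⇔ Tree _∼_ src tgt T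
    isSpanningTree⇔tree = mk⇔
      (λ (con , acyclic) → acyclic⇒independent acyclic , λ u v → linked⇒close T (con u v))
      (λ (indep , tot) → (λ u v → close⇒linked T (tot u v)) , independent⇒acyclic indep)

-- Vertex labellings

Ker : {A : Set} → (Fin n → A) → Rel (Fin n) 0ℓ
Ker f u v = f u ≡ f v

ker-isEquivalence : ∀ {A : Set} (f : Fin n → A) → IsEquivalence (Ker f)
ker-isEquivalence f = record { refl = ≡.refl ; sym = ≡.sym ; trans = ≡.trans }

Surjective : {A : Set} → (Fin n → A) → Set
Surjective f = ∀ y → ∃[ u ] f u ≡ y

swap₀ : Fin r → Fin (suc r) → Fin (suc r)
swap₀ a zero    = suc a
swap₀ a (suc i) = if does (i ≟ᶠ a) then zero else suc i

swap₀-self : ∀ (a : Fin r) → swap₀ a (suc a) ≡ zero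
swap₀-self a rewrite dec-true (a ≟ᶠ a) ≡.refl = ≡.refl

swap₀-other : ∀ (a i : Fin r) → i ≢ a → swap₀ a (suc i) ≡ suc i
swap₀-other a i i≢a rewrite dec-false (i ≟ᶠ a) i≢a = ≡.refl

swap₀-involutive : ∀ (a : Fin r) i → swap₀ a (swap₀ a i) ≡ i
swap₀-involutive a zero = swap₀-self a
swap₀-involutive a (suc i) with i ≟ᶠ a
... | yes i≡a = ≡.cong suc (≡.sym i≡a)
... | no  i≢a = swap₀-other a i i≢a

infix 4 _⇝_
-- Transpositions with the ground label suffice to reach every relabelling required, and for these
-- alone the invariance of the reduced determinant has to be computed.
data _⇝_ {n r} (f : Fin n → Fin (suc r)) : (Fin n → Fin (suc r)) → Set where
  stop : f ⇝ f
  swap : ∀ {g} a → f ⇝ g → f ⇝ swap₀ a ∘ g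

⇝-surjective : ∀ {f g : Fin n → Fin (suc r)} → f ⇝ g → Surjective f → Surjective g
⇝-surjective stop         sur y = sur y
⇝-surjective (swap a f⇝g) sur y with u , eq ← ⇝-surjective f⇝g sur (swap₀ a y) =
  u , ≡.trans (≡.cong (swap₀ a) eq) (swap₀-involutive a y)

⇝-ker⇒ : ∀ {f g : Fin n → Fin (suc r)} → f ⇝ g → Ker f ⇒ Ker g
⇝-ker⇒ stop         eq = eq
⇝-ker⇒ (swap a f⇝g) eq = ≡.cong (swap₀ a) (⇝-ker⇒ f⇝g eq)

⇝-ker⇐ : ∀ {f g : Fin n → Fin (suc r)} → f ⇝ g → Ker g ⇒ Ker f
⇝-ker⇐ stop         eq = eq
⇝-ker⇐ (swap a f⇝g) eq = ⇝-ker⇐ f⇝g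
  (≡.trans (≡.sym (swap₀-involutive a _)) (≡.trans (≡.cong (swap₀ a) eq) (swap₀-involutive a _)))

relabel : ∀ (f : Fin n → Fin (suc (suc r))) {s t} → f s ≢ f t →
          ∃[ g ] f ⇝ g × g s ≡ zero × g t ≡ suc zero
relabel {n} {r} f {s} {t} fs≢ft = move-source (f s) ≡.refl
  where
  move-target : ∀ g → f ⇝ g → g s ≡ zero → ∀ y → g t ≡ y → ∃[ g ] f ⇝ g × g s ≡ zero × g t ≡ suc zero
  move-target g f⇝g gs zero          gt = contradiction (⇝-ker⇐ f⇝g (≡.trans gs (≡.sym gt))) fs≢ft
  move-target g f⇝g gs (suc zero)    gt = g , f⇝g , gs , gt
  move-target g f⇝g gs (suc (suc b)) gt =
    -- Conjugating the transposition of 0 and 1 by that of 0 and b + 2 exchanges 1 and b + 2, and so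
    -- leaves `s` at the ground.
    _ , swap (suc b) (swap zero (swap (suc b) f⇝g)) ,
    ≡.trans (≡.cong cycle gs) (swap₀-self (suc b)) ,
    ≡.trans (≡.cong cycle gt) (≡.cong (swap₀ (suc b) ∘ swap₀ zero) (swap₀-self (suc b)))
    where
    cycle : Fin (suc (suc r)) → Fin (suc (suc r))
    cycle = swap₀ (suc b) ∘ swap₀ zero ∘ swap₀ (suc b)
  move-source : ∀ y → f s ≡ y → ∃[ g ] f ⇝ g × g s ≡ zero × g t ≡ suc zero
  move-source zero    fs = move-target f stop fs _ ≡.refl
  move-source (suc a) fs =
    move-target _ (swap a stop) (≡.trans (≡.cong (swap₀ a) fs) (swap₀-self a)) _ ≡.refl

-- Contraction of an edge whose ends carry the labels 0 and 1. The other labels move down by one,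
-- which matches deleting the first row and column.
collapse : Fin (suc (suc r)) → Fin (suc r)
collapse zero    = zero
collapse (suc i) = i

module _ (g : Fin n → Fin (suc (suc r))) {s t} (gs : g s ≡ zero) (gt : g t ≡ suc zero) where

  collapse-ker⇒ : Merge (Ker g) s t ⇒ Ker (collapse ∘ g)
  collapse-ker⇒ = merge-least (ker-isEquivalence (collapse ∘ g)) (≡.cong collapse)
    (≡.trans (≡.cong collapse gs) (≡.sym (≡.cong collapse gt)))

  collapse-ker⇐ : Ker (collapse ∘ g) ⇒ Merge (Ker g) s t
  collapse-ker⇐ {u} {v} eq with g u in gu | g v in gv
  collapse-ker⇐ {u} {v} eq     | zero  | zero        = inj₁ ≡.refl
  collapse-ker⇐ {u} {v} ≡.refl | zero  | suc .zero   = inj₂ (inj₁ (≡.sym gs , gt))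
  collapse-ker⇐ {u} {v} ≡.refl | suc i | zero        = inj₂ (inj₂ (≡.sym gt , gs))
  collapse-ker⇐ {u} {v} ≡.refl | suc i | suc .i      = inj₁ ≡.refl

  collapse-surjective : Surjective g → Surjective (collapse ∘ g)
  collapse-surjective sur y with u , eq ← sur (suc y) = u , ≡.cong collapse eq

one-label : {i j : Fin 1} → i ≡ j
one-label {zero} {zero} = ≡.refl

-- Each edge of a tree merges two labels, and a total relation leaves only the ground. This fixes
-- the number of components of a contributing forest and settles the edgeless case of the
-- matrix-tree theorem.
tree-size : ∀ (f : Fin n → Fin (suc r)) → Surjective f → ∀ (s t : Fin m → Fin n) J →
            Tree (Ker f) s t J → r ≡ ∣ J ∣
tree-size {r = zero}  f sur s t Vec.[] (_ , tot) = ≡.refl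
tree-size {r = suc r} f sur s t Vec.[] (_ , tot)
  with u , fu ← sur zero | v , fv ← sur (suc zero)
  with () ← ≡.trans (≡.sym fu) (≡.trans (tot u v) fv)
tree-size f sur s t (outside Vec.∷ J) T = tree-size f sur _ _ J T
tree-size {r = zero}  f sur s t (inside Vec.∷ J) ((s≢t , _) , _) = contradiction one-label s≢t
tree-size {r = suc r} f sur s t (inside Vec.∷ J) ((s≢t , i) , tot)
  with g , f⇝g , gs , gt ← relabel f s≢t =
  ≡.cong suc (tree-size (collapse ∘ g) (collapse-surjective g gs gt (⇝-surjective f⇝g sur)) _ _ J
    (tree-resp (λ k → collapse-ker⇒ g gs gt (merge-mono {_∼_ = Ker f} {Ker g} (⇝-ker⇒ f⇝g) k))
               (λ k → merge-mono {_∼_ = Ker g} {Ker f} (⇝-ker⇐ f⇝g) (collapse-ker⇐ g gs gt k)) _ _ J (i , tot)))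

-- Coordinates for the quotient by `∼`. One label is the ground, so `rank` is the size of the
-- reduced Laplacian.
record Labelling (_∼_ : Rel (Fin n) 0ℓ) : Set where
  field
    {rank}     : ℕ
    label      : Fin n → Fin (suc rank)
    surjective : Surjective label
    ∼⇒≡        : _∼_ ⇒ Ker label
    ≡⇒∼        : Ker label ⇒ _∼_

merge-labelling : ∀ {_∼_ : Rel (Fin n) 0ℓ} → Labelling _∼_ → ∀ s t → Labelling (Merge _∼_ s t)
merge-labelling {_∼_ = _∼_} record { rank = r ; label = f ; surjective = sur ; ∼⇒≡ = ∼⇒≡ ; ≡⇒∼ = ≡⇒∼ } s t
  with f s ≟ᶠ f t
... | yes fs≡ft = record
  { label      = f
  ; surjective = sur
  ; ∼⇒≡        = merge-least (ker-isEquivalence f) ∼⇒≡ fs≡ft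
  ; ≡⇒∼        = λ k → inj₁ (≡⇒∼ k)
  }
merge-labelling {_∼_ = _∼_} record { rank = zero  } s t | no fs≢ft = contradiction one-label fs≢ft
merge-labelling {_∼_ = _∼_} record { rank = suc r ; label = f ; surjective = sur ; ∼⇒≡ = ∼⇒≡ ; ≡⇒∼ = ≡⇒∼ } s t | no fs≢ft
  with g , f⇝g , gs , gt ← relabel f fs≢ft = record
  { label      = collapse ∘ g
  ; surjective = collapse-surjective g gs gt (⇝-surjective f⇝g sur)
  ; ∼⇒≡        = λ k → collapse-ker⇒ g gs gt (merge-mono {_∼_ = _∼_} {Ker g} (λ u∼v → ⇝-ker⇒ f⇝g (∼⇒≡ u∼v)) k)
  ; ≡⇒∼        = λ k → merge-mono {_∼_ = Ker g} {_∼_} (λ eq → ≡⇒∼ (⇝-ker⇐ f⇝g eq)) (collapse-ker⇐ g gs gt k)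
  }

close-labelling : ∀ {_∼_ : Rel (Fin n) 0ℓ} → Labelling _∼_ →
                  ∀ (s t : Fin m → Fin n) F → Labelling (Close _∼_ s t F)
close-labelling L s t Vec.[]            = L
close-labelling L s t (outside Vec.∷ F) = close-labelling L _ _ F
close-labelling L s t (inside  Vec.∷ F) = close-labelling (merge-labelling L (s zero) (t zero)) _ _ F

≡-labelling : Fin n → Labelling (_≡_ {A = Fin n})
≡-labelling {suc n} _ = record { label = id ; surjective = λ y → y , ≡.refl ; ∼⇒≡ = id ; ≡⇒∼ = id }

-- Superports

element∈ : ∀ {q} (I : Subset q) i → element I i ∈ I
element∈ (inside  Vec.∷ I) zero    = here
element∈ (inside  Vec.∷ I) (suc i) = there (element∈ I i)
element∈ (outside Vec.∷ I) i       = there (element∈ I i)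

element-injective : ∀ {q} (I : Subset q) {i j} → element I i ≡ element I j → i ≡ j
element-injective (inside  Vec.∷ I) {zero}  {zero}  _  = ≡.refl
element-injective (inside  Vec.∷ I) {suc i} {suc j} eq = ≡.cong suc (element-injective I (sucᶠ-injective eq))
element-injective (outside Vec.∷ I)                 eq = element-injective I (sucᶠ-injective eq)

element-surjective : ∀ {q} (I : Subset q) {x} → x ∈ I → ∃[ i ] element I i ≡ x
element-surjective (inside  Vec.∷ I) here       = zero , ≡.refl
element-surjective (inside  Vec.∷ I) (there x∈) with i , eq ← element-surjective I x∈ = suc i , ≡.cong suc eq
element-surjective (outside Vec.∷ I) (there x∈) with i , eq ← element-surjective I x∈ = i , ≡.cong suc eq

module PortLabels {n p q} (S : Superports n p q) where
  open Superports S

  root≢node : ∀ a i → root a ≢ node i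
  root≢node a i eq with ≡.refl ← disjoint (root∈ a) (≡.subst (_∈ superport (portOf i)) (≡.sym eq) (node∈ i)) =
    node≢root i (≡.sym eq)

  Contracted : Subset q → Rel (Fin n) 0ℓ
  Contracted = Close _≡_ rootOf node

  contracted-isEquivalence : ∀ J → IsEquivalence (Contracted J)
  contracted-isEquivalence = close-isEquivalence ≡.isEquivalence rootOf node

  contracted-edge : ∀ {J i} → i ∈ J → Contracted J (rootOf i) (node i)
  contracted-edge = close-edge ≡.isEquivalence rootOf node

  -- The port edges form stars around the roots: each one contracted leaves the
  -- remaining nodes alone in their classes.
  ports-independent : ∀ J → Independent _≡_ rootOf node J
  ports-independent = leaves-independent rootOf node ≡.isEquivalence node-injective
    (λ i j → root≢node (portOf i) j) λ i eq → ≡.sym eq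
    where
    leaves-independent : ∀ {q} {_∼_ : Rel (Fin n) 0ℓ} (s t : Fin q → Fin n) → IsEquivalence _∼_ →
      (∀ {i j} → t i ≡ t j → i ≡ j) → (∀ i j → s i ≢ t j) → (∀ i {u} → t i ∼ u → u ≡ t i) →
      ∀ J → Independent _∼_ s t J
    leaves-independent s t eq inj s≢t leaf Vec.[]            = tt
    leaves-independent s t eq inj s≢t leaf (outside Vec.∷ J) =
      leaves-independent _ _ eq (λ e → sucᶠ-injective (inj e)) (λ i j → s≢t (suc i) (suc j)) (leaf ∘ suc) J
    leaves-independent s t eq inj s≢t leaf (inside  Vec.∷ J) =
      (λ s∼t → s≢t zero zero (leaf zero (IsEquivalence.sym eq s∼t))) ,
      leaves-independent _ _ (merge-isEquivalence eq _ _) (λ e → sucᶠ-injective (inj e)) (λ i j → s≢t (suc i) (suc j))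
        (λ where
          i (inj₁ a)              → leaf (suc i) a
          i (inj₂ (inj₁ (a , _))) → contradiction (leaf (suc i) a) (s≢t zero (suc i))
          i (inj₂ (inj₂ (a , _))) → case inj (leaf (suc i) a) of λ ())
        J

  isNode? : ∀ v → Dec (∃[ i ] node i ≡ v)
  isNode? v = any? λ i → node i ≟ᶠ v

  -- An explicit retraction onto the vertices that are not nodes. Each class of `≃` has exactly one
  -- of these: the root of a superport, or an interior vertex.
  base : Fin n → Fin n
  base v with isNode? v
  ... | yes (i , _) = rootOf i
  ... | no  _       = v

  base-node : ∀ i → base (node i) ≡ rootOf i
  base-node i with isNode? (node i)
  ... | yes (j , eq) = ≡.cong rootOf (node-injective eq)
  ... | no  ¬node    = contradiction (i , ≡.refl) ¬node

  base-other : ∀ {v} → ¬ (∃[ i ] node i ≡ v) → base v ≡ v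
  base-other {v} ¬node with isNode? v
  ... | yes isNode = contradiction isNode ¬node
  ... | no  _      = ≡.refl

  base-root : ∀ a → base (root a) ≡ root a
  base-root a = base-other λ (i , eq) → root≢node a i (≡.sym eq)

  base-¬node : ∀ v i → node i ≢ base v
  base-¬node v i with isNode? v
  ... | yes (j , _) = λ eq → root≢node (portOf j) i (≡.sym eq)
  ... | no  ¬node   = λ eq → ¬node (i , eq)

  contracted⇒base : Contracted ⊤ ⇒ Ker base
  contracted⇒base = close-least (ker-isEquivalence base) (≡.cong base) rootOf node ⊤
    λ {i} _ → ≡.trans (base-root (portOf i)) (≡.sym (base-node i))

  contracted-base : ∀ J v → (∀ i → node i ≡ v → i ∈ J) → Contracted J v (base v)
  contracted-base J v node∈J with isNode? v
  ... | yes (i , ≡.refl) = IsEquivalence.sym (contracted-isEquivalence J) (contracted-edge (node∈J i ≡.refl))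
  ... | no  _            = IsEquivalence.refl (contracted-isEquivalence J)

  contracted⇒≃ : Contracted ⊤ ⇒ _≃_
  contracted⇒≃ = close-least (IsDecEquivalence.isEquivalence ≃-isDecEquivalence) inj₁ rootOf node ⊤
    λ {i} _ → inj₂ (portOf i , root∈ (portOf i) , node∈ i)

  ≃⇒contracted : ∀ {J} → (∀ i → i ∈ J) → _≃_ ⇒ Contracted J
  ≃⇒contracted {J} all∈J (inj₁ ≡.refl) = IsEquivalence.refl (contracted-isEquivalence J)
  ≃⇒contracted {J} all∈J (inj₂ (a , u∈ , v∈)) =
    IsEquivalence.trans eqJ (IsEquivalence.sym eqJ (from-root u∈)) (from-root v∈)
    where
    eqJ = contracted-isEquivalence J
    from-root : ∀ {a v} → v ∈ superport a → Contracted J (root a) v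
    from-root {a} {v} v∈ with v ≟ᶠ root a
    ... | yes ≡.refl = IsEquivalence.refl eqJ
    ... | no  v≢root with i , ≡.refl ← node-exhaustive v∈ v≢root
                        with ≡.refl ← disjoint (node∈ i) v∈ = contracted-edge (all∈J i)

  contracted⇒contracted : ∀ {J J′} → (∀ {i} → i ∈ J → i ∈ J′) → Contracted J ⇒ Contracted J′
  contracted⇒contracted {J} {J′} J⊆J′ = close-least (contracted-isEquivalence J′)
    (close-⊇ rootOf node J′) rootOf node J (contracted-edge ∘ J⊆J′)

  -- A nonempty boundary guarantees a vertex, hence a ground label.
  some-vertex : Fin n
  some-vertex = root (fromℕ< (ℕ.>-nonZero⁻¹ p {{boundary-nonempty}}))

  classLabelling : Labelling (Contracted ⊤)
  classLabelling = close-labelling (≡-labelling some-vertex) rootOf node ⊤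

  open Labelling classLabelling using ()
    renaming (rank to classRank; label to classLabel; surjective to classLabel-surjective;
              ∼⇒≡ to contracted⇒classLabel; ≡⇒∼ to classLabel⇒contracted) public

  classLabel-base : ∀ v → classLabel (base v) ≡ classLabel v
  classLabel-base v = ≡.sym (contracted⇒classLabel (contracted-base ⊤ v λ _ _ → ∈⊤))

  -- Passing to `base` ensures that the chosen vertex is never a node. It therefore stays in its
  -- superport class when the nodes of `I` are split off, and its voltage is a root or interior
  -- voltage.
  representative : Fin (suc classRank) → Fin n
  representative y = base (proj₁ (classLabel-surjective y))

  classLabel-representative : ∀ y → classLabel (representative y) ≡ y
  classLabel-representative y = ≡.trans (classLabel-base _) (proj₂ (classLabel-surjective y))

  base≡representative : ∀ v → base v ≡ representative (classLabel v)
  base≡representative v = contracted⇒base (classLabel⇒contracted (≡.sym (proj₂ (classLabel-surjective (classLabel v)))))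

  module _ (I : Subset q) where

    freeNode : Fin ∣ I ∣ → Fin n
    freeNode i = node (element I i)

    freeNode-injective : ∀ {i j} → freeNode i ≡ freeNode j → i ≡ j
    freeNode-injective eq = element-injective I (node-injective eq)

    isFree? : ∀ v → Dec (∃[ i ] freeNode i ≡ v)
    isFree? v = any? λ i → freeNode i ≟ᶠ v

    raise : Fin (suc classRank) → Fin (suc (∣ I ∣ +ᴺ classRank))
    raise zero    = zero
    raise (suc y) = suc (∣ I ∣ ↑ʳ y)

    raise-injective : ∀ {x y} → raise x ≡ raise y → x ≡ y
    raise-injective {zero}  {zero}  _  = ≡.refl
    raise-injective {suc x} {suc y} eq = ≡.cong suc (↑ʳ-injective ∣ I ∣ x y (sucᶠ-injective eq))

    raise≢free : ∀ y (i : Fin ∣ I ∣) → raise y ≢ suc (i ↑ˡ classRank)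
    raise≢free (suc y) i eq = case ≡.trans (≡.sym (splitAt-↑ʳ ∣ I ∣ classRank y))
      (≡.trans (≡.cong (splitAt ∣ I ∣) (sucᶠ-injective eq)) (splitAt-↑ˡ ∣ I ∣ i classRank)) of λ ()

    -- When only the ports outside `I` are contracted, a node of `I` is alone in its class, while
    -- every other class still contains its base vertex. The labels of the free nodes come before
    -- the nonzero class labels, which is the block order of the final determinant; `raise` keeps
    -- the ground at 0.
    freeLabel : Fin n → Fin (suc (∣ I ∣ +ᴺ classRank))
    freeLabel v with isFree? v
    ... | yes (i , _) = suc (i ↑ˡ classRank)
    ... | no  _       = raise (classLabel v)

    freeLabel-free : ∀ i → freeLabel (freeNode i) ≡ suc (i ↑ˡ classRank)
    freeLabel-free i with isFree? (freeNode i)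
    ... | yes (j , eq) = ≡.cong (λ j → suc (j ↑ˡ classRank)) (freeNode-injective eq)
    ... | no  ¬free    = contradiction (i , ≡.refl) ¬free

    freeLabel-other : ∀ {v} → ¬ (∃[ i ] freeNode i ≡ v) → freeLabel v ≡ raise (classLabel v)
    freeLabel-other {v} ¬free with isFree? v
    ... | yes free = contradiction free ¬free
    ... | no  _    = ≡.refl

    freeLabel-surjective : Surjective freeLabel
    freeLabel-surjective y = cover y
      where
      covered : ∀ y → freeLabel (representative y) ≡ raise y
      covered y = ≡.trans (freeLabel-other λ (i , eq) → base-¬node _ (element I i) eq)
        (≡.cong raise (classLabel-representative y))
      cover : ∀ y → ∃[ u ] freeLabel u ≡ y
      cover zero = representative zero , covered zero
      cover (suc l) with splitAt ∣ I ∣ l in eq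
      ... | inj₁ i = freeNode i , ≡.trans (freeLabel-free i) (≡.cong suc (splitAt⁻¹-↑ˡ eq))
      ... | inj₂ w = representative (suc w) , ≡.trans (covered (suc w)) (≡.cong suc (splitAt⁻¹-↑ʳ eq))

    contracted⇒freeLabel : Contracted (∁ I) ⇒ Ker freeLabel
    contracted⇒freeLabel = close-least (ker-isEquivalence freeLabel) (≡.cong freeLabel) rootOf node (∁ I) λ {i} i∈∁I →
      ≡.trans (freeLabel-other λ (j , eq) → root≢node (portOf i) (element I j) (≡.sym eq))
        (≡.trans (≡.cong raise (contracted⇒classLabel (contracted-edge ∈⊤)))
          (≡.sym (freeLabel-other λ (j , eq) →
            x∈∁p⇒x∉p i∈∁I (≡.subst (_∈ I) (node-injective eq) (element∈ I j)))))

    freeLabel⇒contracted : Ker freeLabel ⇒ Contracted (∁ I)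
    freeLabel⇒contracted {u} {v} eq with isFree? u | isFree? v
    ... | yes (i , ≡.refl) | yes (j , ≡.refl) with ≡.refl ← ↑ˡ-injective classRank i j (sucᶠ-injective eq) =
      IsEquivalence.refl (contracted-isEquivalence (∁ I))
    ... | yes (i , _) | no _        = contradiction (≡.sym eq) (raise≢free (classLabel v) i)
    ... | no _        | yes (j , _) = contradiction eq (raise≢free (classLabel u) j)
    ... | no ¬free-u  | no ¬free-v  = IsEquivalence.trans eq∁I (to-base u ¬free-u)
      (≡.subst (λ b → Contracted (∁ I) b v) (≡.sym (contracted⇒base (classLabel⇒contracted (raise-injective eq))))
        (IsEquivalence.sym eq∁I (to-base v ¬free-v)))
      where
      eq∁I = contracted-isEquivalence (∁ I)
      to-base : ∀ v → ¬ (∃[ i ] freeNode i ≡ v) → Contracted (∁ I) v (base v)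
      to-base v ¬free = contracted-base (∁ I) v λ i nodei≡v → x∉p⇒x∈∁p λ i∈I →
        let j , eq = element-surjective I i∈I in ¬free (j , ≡.trans (≡.cong node eq) nodei≡v)

-- Valid and contributing forests as trees of contracted networks

module _ {n m p q} (G : SimpleGraph n m) (S : Superports n p q) where
  open SimpleGraph G
  open Superports S
  open PortLabels S

  private
    Forest : Subset m → Rel (Fin n) 0ℓ
    Forest = Close _≡_ src tgt

    forest⇒linked : ∀ F → Forest F ⇒ Linked multigraph F
    forest⇒linked = close⇒linked multigraph

    linked⇒forest : ∀ F → Linked multigraph F ⇒ Forest F
    linked⇒forest = linked⇒close multigraph

  contributes⇒tree : ∀ I F → Contributes G S I F → Tree (Ker (freeLabel I)) src tgt F
  contributes⇒tree I F (acyclic , _ , spanning)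
    with j , tot ← tree-resp (linked⇒forest F) (forest⇒linked F) rootOf node (∁ I)
                     (Equivalence.to (isSpanningTree⇔tree (quotientPortGraph G S F) (∁ I)) spanning)
    with _ , i ← independent-comm ≡.isEquivalence rootOf node (∁ I) src tgt F
                   (acyclic⇒independent multigraph F acyclic) j =
    tree-resp (contracted⇒freeLabel I) (freeLabel⇒contracted I) src tgt F
      (i , λ u v → close-comm ≡.isEquivalence src tgt F rootOf node (∁ I) (tot u v))

  tree⇒contributes : ∀ I F → Tree (Ker (freeLabel I)) src tgt F → Contributes G S I F
  tree⇒contributes I F T
    with i , tot ← tree-resp (freeLabel⇒contracted I) (contracted⇒freeLabel I) src tgt F T
    with i′ , j ← independent-comm ≡.isEquivalence src tgt F rootOf node (∁ I) (ports-independent (∁ I)) i =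
    independent⇒acyclic multigraph F i′ , components ,
    Equivalence.from (isSpanningTree⇔tree (quotientPortGraph G S F) (∁ I))
      (tree-resp (forest⇒linked F) (linked⇒forest F) rootOf node (∁ I) portTree)
    where
    portTree : Tree (Forest F) rootOf node (∁ I)
    portTree = j , λ u v → close-comm ≡.isEquivalence rootOf node (∁ I) src tgt F (tot u v)
    open Labelling (close-labelling (≡-labelling some-vertex) src tgt F)
    -- The complement of `I` is a spanning tree on the components of `F`, so there is one component
    -- more than it has edges.
    rank≡ : suc rank ≡ q ∸ ∣ I ∣ +ᴺ 1
    rank≡ = ≡.trans (≡.cong suc (≡.trans
      (tree-size label surjective rootOf node (∁ I) (tree-resp ∼⇒≡ ≡⇒∼ rootOf node (∁ I) portTree))
      (∣∁p∣≡n∸∣p∣ I))) (ℕₚ.+-comm 1 _)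
    components : HasComponents G S (q ∸ ∣ I ∣ +ᴺ 1) F
    components = ≡.subst (λ k → HasComponents G S k F) rank≡ (record
      { to        = label
      ; cong      = ∼⇒≡ ∘ linked⇒forest F
      ; bijective = forest⇒linked F ∘ ≡⇒∼ ,
          λ y → proj₁ (surjective y) , λ z → ≡.trans (∼⇒≡ (linked⇒forest F z)) (proj₂ (surjective y))
      })

  contributes⇔tree : ∀ I F → Contributes G S I F ⇔ Tree (Ker (freeLabel I)) src tgt F
  contributes⇔tree I F = mk⇔ (contributes⇒tree I F) (tree⇒contributes I F)

  valid⇔tree-≃ : ∀ F → IsValid G S F ⇔ Tree _≃_ src tgt F
  valid⇔tree-≃ F = mk⇔ (to ∘ proj₂)
    λ T → independent⇒acyclic multigraph F (independent-anti inj₁ src tgt F (proj₁ T)) , from T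
    where open Equivalence (isSpanningTree⇔tree (quotientNetwork G S) F)

  valid⇔tree-class : ∀ F → IsValid G S F ⇔ Tree (Ker classLabel) src tgt F
  valid⇔tree-class F = mk⇔
    (λ v → tree-resp (contracted⇒classLabel ∘ ≃⇒contracted (λ _ → ∈⊤)) (contracted⇒≃ ∘ classLabel⇒contracted)
      src tgt F (to v))
    (λ T → from (tree-resp (contracted⇒≃ ∘ classLabel⇒contracted) (contracted⇒classLabel ∘ ≃⇒contracted (λ _ → ∈⊤))
      src tgt F T))
    where open Equivalence (valid⇔tree-≃ F)

  -- This accounts for the convention that Ψ of the empty set is Φ_valid: with no free node, all
  -- ports are contracted and the labels separate exactly the classes of `≃`.
  valid⇔tree-free : ∀ I → ¬ Nonempty I → ∀ F → IsValid G S F ⇔ Tree (Ker (freeLabel I)) src tgt F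
  valid⇔tree-free I empty F = mk⇔
    (λ v → tree-resp there′ back src tgt F (to v)) (λ T → from (tree-resp back there′ src tgt F T))
    where
    open Equivalence (valid⇔tree-≃ F)
    there′ : _≃_ ⇒ Ker (freeLabel I)
    there′ = contracted⇒freeLabel I ∘ ≃⇒contracted λ i → x∉p⇒x∈∁p λ i∈I → empty (i , i∈I)
    back : Ker (freeLabel I) ⇒ _≃_
    back = contracted⇒≃ ∘ contracted⇒contracted {∁ I} (λ _ → ∈⊤) ∘ freeLabel⇒contracted I

  -- Connectedness of the graph passes to the quotient network, where the greedy tree exists.
  valid-exists : ∃ (IsValid G S)
  valid-exists
    with F , T ← spanning-tree (IsDecEquivalence.isEquivalence ≃-isDecEquivalence)
                   (IsDecEquivalence._≟_ ≃-isDecEquivalence) src tgt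
                   (λ u v → close-mono inj₁ src tgt ⊤ (linked⇒forest ⊤ (connected u v))) =
    F , Equivalence.from (valid⇔tree-≃ F) T

-- Finite sums and linear algebra over the field

module LinearAlgebra {c ℓ₁ ℓ₂} (K : OrderedField c ℓ₁ ℓ₂) where
  open OrderedField K hiding (zero; ∑) public
  module R = CommutativeRing commutativeRing
  open RingProperties R.ring public
    using (-‿involutive; -‿+-comm; -‿distribˡ-*; -‿distribʳ-*; -0#≈0#; -1*x≈-x)
  private module Sum = SemiringSum R.semiring
  open SetoidReasoning R.setoid public
  open CommutativeSemigroupProperties R.*-commutativeSemigroup public
    using (x∙yz≈y∙xz; xy∙z≈xz∙y)
  module + = CommutativeSemigroupProperties R.+-commutativeSemigroup

  private variable
    s t : ℕ

  -- Opaque copies of the sum and of the determinant, so that unification does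
  -- not unfold them.
  opaque
    ∑ : Vector Carrier n → Carrier
    ∑ = OrderedField.∑ K

    ∑-def : (x : Vector Carrier n) → ∑ x ≡ OrderedField.∑ K x
    ∑-def x = ≡.refl

    ∑-empty : (x : Vector Carrier zero) → ∑ x ≈ 0#
    ∑-empty x = refl

    ∑-suc : (x : Vector Carrier (suc n)) → ∑ x ≈ x zero + ∑ (x ∘ suc)
    ∑-suc x = refl

    ∑-cong : {x y : Vector Carrier n} → (∀ i → x i ≈ y i) → ∑ x ≈ ∑ y
    ∑-cong = Sum.sum-cong-≋

    ∑-distrib-+ : (x y : Vector Carrier n) → ∑ (λ i → x i + y i) ≈ ∑ x + ∑ y
    ∑-distrib-+ = Sum.∑-distrib-+

    ∑-comm : (x : Matrix K m n) → ∑ (λ i → ∑ λ j → x i j) ≈ ∑ (λ j → ∑ λ i → x i j)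
    ∑-comm = Sum.∑-comm

    *-distribˡ-∑ : ∀ a (x : Vector Carrier n) → a * ∑ x ≈ ∑ λ i → a * x i
    *-distribˡ-∑ = Sum.*-distribˡ-sum

    *-distribʳ-∑ : ∀ a (x : Vector Carrier n) → ∑ x * a ≈ ∑ λ i → x i * a
    *-distribʳ-∑ = Sum.*-distribʳ-sum

    ∑-zero : {x : Vector Carrier n} → (∀ i → x i ≈ 0#) → ∑ x ≈ 0#
    ∑-zero {n} x≈0 = trans (∑-cong x≈0) (Sum.sum-replicate-zero n)

    determinant : Matrix K n n → Carrier
    determinant = det K

    determinant-def : (A : Matrix K n n) → determinant A ≡ det K A
    determinant-def A = ≡.refl

    determinant-empty : (A : Matrix K zero zero) → determinant A ≈ 1#
    determinant-empty A = refl

    expand-row : (A : Matrix K (suc n) (suc n)) →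
      determinant A ≈ ∑ λ j → sign K (toℕ j) * A zero j * determinant (λ i k → A (suc i) (punchIn j k))
    expand-row A = refl

  ∑-neg : (x : Vector Carrier n) → ∑ (λ i → - x i) ≈ - ∑ x
  ∑-neg x = begin
    ∑ (λ i → - x i)       ≈⟨ ∑-cong (λ i → -1*x≈-x (x i)) ⟨
    ∑ (λ i → - 1# * x i)  ≈⟨ *-distribˡ-∑ (- 1#) x ⟨
    - 1# * ∑ x            ≈⟨ -1*x≈-x (∑ x) ⟩
    - ∑ x                 ∎

  ∑-single : (a : Fin n) {x : Vector Carrier n} → (∀ i → i ≢ a → x i ≈ 0#) → ∑ x ≈ x a
  ∑-single zero    x≈0 = trans (∑-suc _) (trans (+-congˡ (∑-zero λ i → x≈0 (suc i) λ ())) (+-identityʳ _))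
  ∑-single (suc a) x≈0 = trans (∑-suc _)
    (trans (+-cong (x≈0 zero λ ()) (∑-single a λ i i≢a → x≈0 (suc i) λ where ≡.refl → i≢a ≡.refl))
           (+-identityˡ _))

  ∑-splitAt : ∀ r {s} (x : Vector Carrier (r +ᴺ s)) → ∑ x ≈ ∑ (λ i → x (i ↑ˡ s)) + ∑ (λ j → x (r ↑ʳ j))
  ∑-splitAt zero    x = trans (sym (+-identityˡ _)) (+-congʳ (sym (∑-empty _)))
  ∑-splitAt (suc r) x = trans (∑-suc x)
    (trans (+-congˡ (∑-splitAt r (x ∘ suc))) (trans (sym (+-assoc _ _ _)) (+-congʳ (sym (∑-suc _)))))

  ∑-exchange : (x : Vector Carrier m) (κ : Vector Carrier n) (y : Matrix K n m) →
               ∑ (λ j → x j * ∑ (λ l → κ l * y l j)) ≈ ∑ (λ l → κ l * ∑ (λ j → x j * y l j))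
  ∑-exchange x κ y = begin
    ∑ (λ j → x j * ∑ (λ l → κ l * y l j))    ≈⟨ ∑-cong (λ j → *-distribˡ-∑ (x j) (λ l → κ l * y l j)) ⟩
    ∑ (λ j → ∑ (λ l → x j * (κ l * y l j)))  ≈⟨ ∑-comm (λ j l → x j * (κ l * y l j)) ⟩
    ∑ (λ l → ∑ (λ j → x j * (κ l * y l j)))  ≈⟨ ∑-cong (λ l → ∑-cong λ j → x∙yz≈y∙xz (x j) (κ l) (y l j)) ⟩
    ∑ (λ l → ∑ (λ j → κ l * (x j * y l j)))  ≈⟨ ∑-cong (λ l → *-distribˡ-∑ (κ l) (λ j → x j * y l j)) ⟨
    ∑ (λ l → κ l * ∑ (λ j → x j * y l j))    ∎

  -- Determinants: expansion, multilinearity, alternation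

  infix 4 _≈ᴹ_
  _≈ᴹ_ : Matrix K r s → Matrix K r s → Set ℓ₁
  A ≈ᴹ B = ∀ i j → A i j ≈ B i j

  determinant-cong : {A B : Matrix K n n} → A ≈ᴹ B → determinant A ≈ determinant B
  determinant-cong {zero}  A≈B = trans (determinant-empty _) (sym (determinant-empty _))
  determinant-cong {suc n} A≈B = trans (expand-row _) (trans
    (∑-cong λ j → *-cong (*-congˡ (A≈B zero j)) (determinant-cong λ i k → A≈B (suc i) (punchIn j k)))
    (sym (expand-row _)))

  -- The definition expands along the first row. Expanding its minors along their first column and
  -- exchanging the sums leads to the double minors `D`; `neg-move` shifts the sign of the increased
  -- index from the column to the row.
  expand-column : (A : Matrix K (suc n) (suc n)) →
    determinant A ≈ ∑ λ i → sign K (toℕ i) * A i zero * determinant (λ a b → A (punchIn i a) (suc b))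
  expand-column {zero}  A = trans (expand-row A) (∑-cong λ { zero → *-congˡ (trans (determinant-empty _) (sym (determinant-empty _))) })
  expand-column {suc n} A = trans (expand-row A) (trans (∑-suc _) (trans (+-congˡ (begin
    ∑ (λ j → - σ j * A zero (suc j) * determinant (λ a b → A (suc a) (punchIn (suc j) b)))
      ≈⟨ ∑-cong (λ j → *-congˡ (expand-column (λ a b → A (suc a) (punchIn (suc j) b)))) ⟩
    ∑ (λ j → - σ j * A zero (suc j) * ∑ (λ i → σ i * A (suc i) zero * D i j))
      ≈⟨ ∑-exchange _ (λ i → σ i * A (suc i) zero) D ⟩
    ∑ (λ i → σ i * A (suc i) zero * ∑ (λ j → - σ j * A zero (suc j) * D i j))
      ≈⟨ ∑-cong (λ i → trans (*-distribˡ-∑ _ (λ j → - σ j * A zero (suc j) * D i j))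
           (trans (∑-cong λ j → neg-move (σ i) (A (suc i) zero) (σ j) (A zero (suc j)) (D i j))
             (sym (*-distribˡ-∑ _ (λ j → σ j * A zero (suc j) * D i j))))) ⟩
    ∑ (λ i → - σ i * A (suc i) zero * ∑ (λ j → σ j * A zero (suc j) * D i j))
      ≈⟨ ∑-cong (λ i → *-congˡ (expand-row (λ a b → A (punchIn (suc i) a) (suc b)))) ⟨
    ∑ (λ i → - σ i * A (suc i) zero * determinant (λ a b → A (punchIn (suc i) a) (suc b))) ∎)) (sym (∑-suc _))))
    where
    σ : ∀ {k} → Fin k → Carrier
    σ i = sign K (toℕ i)
    D : Fin (suc n) → Fin (suc n) → Carrier
    D i j = determinant (λ a b → A (suc (punchIn i a)) (suc (punchIn j b)))
    neg-move : ∀ x a y b d → x * a * (- y * b * d) ≈ - x * a * (y * b * d)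
    neg-move x a y b d = begin
      x * a * (- y * b * d)    ≈⟨ *-congˡ (trans (*-congʳ (sym (-‿distribˡ-* y b))) (sym (-‿distribˡ-* (y * b) d))) ⟩
      x * a * - (y * b * d)    ≈⟨ -‿distribʳ-* (x * a) (y * b * d) ⟨
      - (x * a * (y * b * d))  ≈⟨ -‿distribˡ-* (x * a) (y * b * d) ⟩
      - (x * a) * (y * b * d)  ≈⟨ *-congʳ (-‿distribˡ-* x a) ⟩
      - x * a * (y * b * d)    ∎

  determinant-transpose : (A : Matrix K n n) → determinant (λ i j → A j i) ≈ determinant A
  determinant-transpose {zero}  A = determinant-cong λ ()
  determinant-transpose {suc n} A = trans (expand-row (λ i j → A j i)) (trans
    (∑-cong λ j → *-congˡ (determinant-transpose (λ a b → A (punchIn j a) (suc b))))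
    (sym (expand-column A)))

  replaceRow : Fin r → Vector Carrier s → Matrix K r s → Matrix K r s
  replaceRow a v A = updateAt A a (const v)

  private
    replaceRow-columns : ∀ (a : Fin r) (v : Vector Carrier s) A (g : Fin t → Fin s) i k →
      replaceRow a v A i (g k) ≡ replaceRow a (v ∘ g) (λ i k → A i (g k)) i k
    replaceRow-columns zero    v A g zero    k = ≡.refl
    replaceRow-columns zero    v A g (suc i) k = ≡.refl
    replaceRow-columns (suc a) v A g zero    k = ≡.refl
    replaceRow-columns (suc a) v A g (suc i) k = replaceRow-columns a v (A ∘ suc) g i k

    minor₀ : Matrix K (suc n) (suc n) → Fin (suc n) → Matrix K n n
    minor₀ A j i k = A (suc i) (punchIn j k)

    expand-replaceRow : ∀ (a : Fin n) v (A : Matrix K (suc n) (suc n)) →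
      determinant (replaceRow (suc a) v A) ≈
      ∑ λ j → sign K (toℕ j) * A zero j * determinant (replaceRow a (v ∘ punchIn j) (minor₀ A j))
    expand-replaceRow a v A = trans (expand-row _) (∑-cong λ j → *-congˡ (determinant-cong λ i k →
      reflexive (replaceRow-columns a v (A ∘ suc) (punchIn j) i k)))

  determinant-linear : ∀ (a : Fin n) (κ : Vector Carrier m) (V : Matrix K m n) (A : Matrix K n n) →
    determinant (replaceRow a (λ k → ∑ λ l → κ l * V l k) A) ≈ ∑ λ l → κ l * determinant (replaceRow a (V l) A)
  determinant-linear zero κ V A = begin
    _                                              ≈⟨ expand-row _ ⟩
    ∑ (λ j → σ j * ∑ (λ l → κ l * V l j) * D j)    ≈⟨ ∑-cong (λ j → xy∙z≈xz∙y (σ j) _ (D j)) ⟩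
    ∑ (λ j → σ j * D j * ∑ (λ l → κ l * V l j))    ≈⟨ ∑-exchange (λ j → σ j * D j) κ V ⟩
    ∑ (λ l → κ l * ∑ (λ j → σ j * D j * V l j))
      ≈⟨ ∑-cong (λ l → *-congˡ (∑-cong λ j → sym (xy∙z≈xz∙y (σ j) (V l j) (D j)))) ⟩
    ∑ (λ l → κ l * ∑ (λ j → σ j * V l j * D j))    ≈⟨ ∑-cong (λ l → *-congˡ (expand-row _)) ⟨
    _                                              ∎
    where
    σ D : Fin _ → Carrier
    σ i = sign K (toℕ i)
    D j = determinant (minor₀ A j)
  determinant-linear (suc a) κ V A = begin
    _
      ≈⟨ expand-replaceRow a _ A ⟩
    ∑ (λ j → σ j * determinant (replaceRow a (λ k → ∑ λ l → κ l * V l (punchIn j k)) (minor₀ A j)))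
      ≈⟨ ∑-cong (λ j → *-congˡ (determinant-linear a κ (λ l → V l ∘ punchIn j) (minor₀ A j))) ⟩
    ∑ (λ j → σ j * ∑ (λ l → κ l * determinant (replaceRow a (V l ∘ punchIn j) (minor₀ A j))))
      ≈⟨ ∑-exchange σ κ (λ l j → determinant (replaceRow a (V l ∘ punchIn j) (minor₀ A j))) ⟩
    ∑ (λ l → κ l * ∑ (λ j → σ j * determinant (replaceRow a (V l ∘ punchIn j) (minor₀ A j))))
      ≈⟨ ∑-cong (λ l → *-congˡ (expand-replaceRow a (V l) A)) ⟨
    _ ∎
    where
    σ : Fin _ → Carrier
    σ j = sign K (toℕ j) * A zero j

  swapAt : Fin n → Fin (suc n) → Fin (suc n)
  swapAt zero    zero          = suc zero
  swapAt zero    (suc zero)    = zero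
  swapAt zero    (suc (suc i)) = suc (suc i)
  swapAt (suc k) zero          = zero
  swapAt (suc k) (suc i)       = suc (swapAt k i)

  private
    neg-*ˡ : ∀ x y z → - x * y * z ≈ - (x * y * z)
    neg-*ˡ x y z = trans (*-congʳ (sym (-‿distribˡ-* x y))) (sym (-‿distribˡ-* (x * y) z))

    neg-term : ∀ x {y z} → y ≈ - z → x * y ≈ - (x * z)
    neg-term x {y} {z} y≈-z = trans (*-congˡ y≈-z) (sym (-‿distribʳ-* x z))

    minorᶜ : Matrix K (suc n) (suc n) → Fin (suc n) → Matrix K n n
    minorᶜ A i a b = A (punchIn i a) (suc b)

    expand-column₂ : (A : Matrix K (suc (suc n)) (suc (suc n))) →
      determinant A ≈
      1# * A zero zero * determinant (minorᶜ A zero) +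
      (- (1# * A (suc zero) zero * determinant (minorᶜ A (suc zero))) +
       ∑ λ i → - - sign K (toℕ i) * A (suc (suc i)) zero * determinant (minorᶜ A (suc (suc i))))
    expand-column₂ A = trans (expand-column A) (trans (∑-suc _)
      (+-congˡ (trans (∑-suc _) (+-congʳ (neg-*ˡ 1# _ _)))))

  -- Swapping the two top rows exchanges the first two terms of the column expansion and swaps the
  -- two top rows in all other minors. A lower adjacent pair lies inside every minor of the first
  -- row.
  determinant-swapAt : ∀ (k : Fin n) (A : Matrix K (suc n) (suc n)) → determinant (A ∘ swapAt k) ≈ - determinant A
  determinant-swapAt {suc n} zero A = begin
    determinant (A ∘ swapAt zero)       ≈⟨ expand-column₂ (A ∘ swapAt zero) ⟩
    1# * y * _ + (- (1# * x * _) + ∑ (λ i → w i * _))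
      ≈⟨ +-cong (*-congˡ (determinant-cong λ { zero _ → refl ; (suc _) _ → refl }))
           (+-cong (-‿cong (*-congˡ (determinant-cong λ { zero _ → refl ; (suc _) _ → refl })))
             (trans (∑-cong λ i → neg-term (w i) (swap-minor A i)) (∑-neg _))) ⟩
    Y + (- X + - T)                     ≈⟨ rearrange Y X T ⟩
    - (X + (- Y + T))                   ≈⟨ -‿cong (expand-column₂ A) ⟨
    - determinant A                     ∎
    where
    x y X Y T : Carrier
    w : Fin n → Carrier
    x = A zero zero
    y = A (suc zero) zero
    w i = - - sign K (toℕ i) * A (suc (suc i)) zero
    X = 1# * x * determinant (minorᶜ A zero)
    Y = 1# * y * determinant (minorᶜ A (suc zero))
    T = ∑ (λ i → w i * determinant (minorᶜ A (suc (suc i))))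
    swap-minor : ∀ {n} (A : Matrix K (suc (suc n)) (suc (suc n))) i →
      determinant (minorᶜ (A ∘ swapAt zero) (suc (suc i))) ≈ - determinant (minorᶜ A (suc (suc i)))
    swap-minor {suc n} A i = trans
      (determinant-cong λ { zero _ → refl ; (suc zero) _ → refl ; (suc (suc _)) _ → refl })
      (determinant-swapAt zero (minorᶜ A (suc (suc i))))
    rearrange : ∀ a b c → a + (- b + - c) ≈ - (b + (- a + c))
    rearrange a b c = begin
      a + (- b + - c)        ≈⟨ +.x∙yz≈y∙xz a (- b) (- c) ⟩
      - b + (a + - c)        ≈⟨ +-congˡ (+-congʳ (sym (-‿involutive a))) ⟩
      - b + (- - a + - c)    ≈⟨ +-congˡ (-‿+-comm (- a) c) ⟩
      - b + - (- a + c)      ≈⟨ -‿+-comm b (- a + c) ⟩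
      - (b + (- a + c))      ∎
  determinant-swapAt (suc k) A = begin
    determinant (A ∘ swapAt (suc k))
      ≈⟨ expand-row _ ⟩
    ∑ (λ j → sign K (toℕ j) * A zero j * determinant (minor₀ A j ∘ swapAt k))
      ≈⟨ ∑-cong (λ j → neg-term (sign K (toℕ j) * A zero j) (determinant-swapAt k (minor₀ A j))) ⟩
    ∑ (λ j → - (sign K (toℕ j) * A zero j * determinant (minor₀ A j)))
      ≈⟨ ∑-neg _ ⟩
    - ∑ (λ j → sign K (toℕ j) * A zero j * determinant (minor₀ A j))
      ≈⟨ -‿cong (expand-row A) ⟨
    - determinant A ∎

  private
    -- The first two terms of the column expansion cancel, and every other minor again has equal top
    -- rows. Arguing from `determinant-swapAt` would only give d = - d and call for a division by
    -- two.
    row₀≈row₁⇒0 : ∀ (A : Matrix K (suc (suc n)) (suc (suc n))) →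
      (∀ j → A zero j ≈ A (suc zero) j) → determinant A ≈ 0#
    row₀≈row₁⇒0 A eq = begin
      determinant A  ≈⟨ expand-column₂ A ⟩
      1# * A zero zero * _ + (- E + ∑ _)
        ≈⟨ +-cong (*-cong (*-congˡ (eq zero)) (determinant-cong λ { zero j → sym (eq (suc j)) ; (suc _) _ → refl }))
             (+-congˡ (∑-zero λ i → trans (*-congˡ (minor≈0 A eq i)) (zeroʳ _))) ⟩
      E + (- E + 0#)  ≈⟨ trans (+-congˡ (+-identityʳ _)) (-‿inverseʳ E) ⟩
      0# ∎
      where
      E : Carrier
      E = 1# * A (suc zero) zero * determinant (minorᶜ A (suc zero))
      minor≈0 : ∀ {n} (A : Matrix K (suc (suc n)) (suc (suc n))) → (∀ j → A zero j ≈ A (suc zero) j) →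
        ∀ i → determinant (minorᶜ A (suc (suc i))) ≈ 0#
      minor≈0 {suc n} A eq i = row₀≈row₁⇒0 _ λ j → eq (suc j)

    -- Adjacent swaps move the equal row up until it lies directly below row 0.
    row₀≈row⇒0 : ∀ (k : Fin n) (A : Matrix K (suc n) (suc n)) →
      (∀ j → A zero j ≈ A (suc k) j) → determinant A ≈ 0#
    row₀≈row⇒0 {suc n} = <-weakInduction _ row₀≈row₁⇒0 λ k vanish A eq → begin
      determinant A                         ≈⟨ -‿involutive _ ⟨
      - - determinant A                     ≈⟨ -‿cong (determinant-swapAt (suc k) A) ⟨
      - determinant (A ∘ swapAt (suc k))
        ≈⟨ -‿cong (vanish (A ∘ swapAt (suc k)) λ j →
             trans (eq j) (reflexive (≡.cong (λ l → A (suc l) j) (≡.sym (swapAt-inject₁ k))))) ⟩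
      - 0#                                  ≈⟨ -0#≈0# ⟩
      0#                                    ∎
      where
      swapAt-inject₁ : ∀ {n} (k : Fin n) → swapAt k (inject₁ k) ≡ suc k
      swapAt-inject₁ zero    = ≡.refl
      swapAt-inject₁ (suc k) = ≡.cong suc (swapAt-inject₁ k)

  determinant-alternating : ∀ (a b : Fin n) (A : Matrix K n n) → a ≢ b →
    (∀ j → A a j ≈ A b j) → determinant A ≈ 0#
  determinant-alternating zero    zero    A a≢b eq = contradiction ≡.refl a≢b
  determinant-alternating zero    (suc b) A a≢b eq = row₀≈row⇒0 b A eq
  determinant-alternating (suc a) zero    A a≢b eq = row₀≈row⇒0 a A (sym ∘ eq)
  determinant-alternating (suc a) (suc b) A a≢b eq = trans (expand-row A) (∑-zero λ j →
    trans (*-congˡ (determinant-alternating a b _ (a≢b ∘ ≡.cong suc) (eq ∘ punchIn j))) (zeroʳ _))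

  -- By linearity only the multiple of the old row survives; every other term repeats a row. The
  -- elementary row operations below are instances with suitable `κ`.
  determinant-replaceRow : ∀ (a : Fin n) (κ : Vector Carrier n) (A : Matrix K n n) →
    determinant (replaceRow a (λ k → ∑ λ l → κ l * A l k) A) ≈ κ a * determinant A
  determinant-replaceRow a κ A = begin
    determinant (replaceRow a (λ k → ∑ λ l → κ l * A l k) A)  ≈⟨ determinant-linear a κ A A ⟩
    ∑ (λ l → κ l * determinant (replaceRow a (A l) A))
      ≈⟨ ∑-single a (λ l l≢a → trans (*-congˡ (other l l≢a)) (zeroʳ _)) ⟩
    κ a * determinant (replaceRow a (A a) A)                  ≈⟨ *-congˡ (determinant-cong self) ⟩
    κ a * determinant A                                       ∎
    where
    self : replaceRow a (A a) A ≈ᴹ A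
    self i k = reflexive (≡.cong (λ row → row k) (updateAt-id-local a A ≡.refl i))
    other : ∀ l → l ≢ a → determinant (replaceRow a (A l) A) ≈ 0#
    other l l≢a = determinant-alternating a l _ (l≢a ∘ ≡.sym) λ j →
      reflexive (≡.cong (λ row → row j) (≡.trans (updateAt-updates a A) (≡.sym (updateAt-minimal l a A l≢a))))

  δ : Fin n → Fin n → Carrier
  δ i j = if does (i ≟ᶠ j) then 1# else 0#

  δ-≡ : ∀ (i j : Fin n) → i ≡ j → δ i j ≡ 1#
  δ-≡ i j i≡j rewrite dec-true (i ≟ᶠ j) i≡j = ≡.refl

  δ-≢ : ∀ (i j : Fin n) → i ≢ j → δ i j ≡ 0#
  δ-≢ i j i≢j rewrite dec-false (i ≟ᶠ j) i≢j = ≡.refl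

  ∑-δ : ∀ (a : Fin n) (x : Vector Carrier n) → ∑ (λ i → δ a i * x i) ≈ x a
  ∑-δ a x = trans
    (∑-single a λ i i≢a → trans (*-congʳ (reflexive (δ-≢ a i (i≢a ∘ ≡.sym)))) (zeroˡ _))
    (trans (*-congʳ (reflexive (δ-≡ a a ≡.refl))) (*-identityˡ _))

  -- Block triangular form and simultaneous row additions

  padˡ : ∀ r → Vector Carrier s → Vector Carrier (r +ᴺ s)
  padˡ r x = replicate r 0# ++ x

  padˡ-↑ˡ : ∀ r (x : Vector Carrier s) i → padˡ r x (i ↑ˡ s) ≡ 0#
  padˡ-↑ˡ {s} r x i rewrite splitAt-↑ˡ r i s = ≡.refl

  padˡ-↑ʳ : ∀ r (x : Vector Carrier s) i → padˡ r x (r ↑ʳ i) ≡ x i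
  padˡ-↑ʳ {s} r x i rewrite splitAt-↑ʳ r s i = ≡.refl

  ∑-padˡ : ∀ r (x : Vector Carrier s) (y : Vector Carrier (r +ᴺ s)) → ∑ (λ l → padˡ r x l * y l) ≈ ∑ (λ w → x w * y (r ↑ʳ w))
  ∑-padˡ r x y = trans (∑-splitAt r _) (trans
    (+-cong (∑-zero λ i → trans (*-congʳ (reflexive (padˡ-↑ˡ r x i))) (zeroˡ _))
            (∑-cong λ w → *-congʳ (reflexive (padˡ-↑ʳ r x w))))
    (+-identityˡ _))

  private
    punchIn-↑ˡ-↑ˡ : ∀ {r} (j : Fin (suc r)) (c : Fin r) s → punchIn (j ↑ˡ s) (c ↑ˡ s) ≡ punchIn j c ↑ˡ s
    punchIn-↑ˡ-↑ˡ zero    c       s = ≡.refl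
    punchIn-↑ˡ-↑ˡ (suc j) zero    s = ≡.refl
    punchIn-↑ˡ-↑ˡ (suc j) (suc c) s = ≡.cong suc (punchIn-↑ˡ-↑ˡ j c s)

    punchIn-↑ˡ-↑ʳ : ∀ {r} (j : Fin (suc r)) {s} (w : Fin s) → punchIn (j ↑ˡ s) (r ↑ʳ w) ≡ suc (r ↑ʳ w)
    punchIn-↑ˡ-↑ʳ {r}     zero    w = ≡.refl
    punchIn-↑ˡ-↑ʳ {suc r} (suc j) w = ≡.cong suc (punchIn-↑ˡ-↑ʳ j w)

  -- The hypotheses say that adding `Z` times the bottom rows turns the top rows into (L , 0): a
  -- Schur complement with the multipliers given instead of an inverse. The top row is replaced
  -- first; in its expansion only the left columns survive, and their minors satisfy the hypotheses
  -- with the remaining rows of `Z`.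
  determinant-block : ∀ r {s} (M : Matrix K (r +ᴺ s) (r +ᴺ s)) (Z : Matrix K r s) (L : Matrix K r r) →
    (∀ i j → M (i ↑ˡ s) (j ↑ˡ s) + ∑ (λ w → Z i w * M (r ↑ʳ w) (j ↑ˡ s)) ≈ L i j) →
    (∀ i v → M (i ↑ˡ s) (r ↑ʳ v) + ∑ (λ w → Z i w * M (r ↑ʳ w) (r ↑ʳ v)) ≈ 0#) →
    determinant M ≈ determinant L * determinant (λ v w → M (r ↑ʳ v) (r ↑ʳ w))
  determinant-block zero M Z L _ _ = trans (sym (*-identityˡ _)) (*-congʳ (sym (determinant-empty L)))
  determinant-block (suc r) {s} M Z L left right = begin
    determinant M
      ≈⟨ *-identityˡ _ ⟨
    1# * determinant M
      ≈⟨ determinant-replaceRow zero κ M ⟨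
    determinant M′
      ≈⟨ expand-row M′ ⟩
    ∑ (λ j → σ j * M′ zero j * determinant (minor₀ M j))
      ≈⟨ ∑-splitAt (suc r) _ ⟩
    ∑ (λ j → σ (j ↑ˡ s) * M′ zero (j ↑ˡ s) * determinant (minor₀ M (j ↑ˡ s))) +
    ∑ (λ w → σ (suc r ↑ʳ w) * M′ zero (suc r ↑ʳ w) * determinant (minor₀ M (suc r ↑ʳ w)))
      ≈⟨ +-cong
           (∑-cong λ j → *-cong
             (*-cong (reflexive (≡.cong (sign K) (toℕ-↑ˡ j s))) (trans (combine (j ↑ˡ s)) (left zero j)))
             (determinant-block r (minor₀ M (j ↑ˡ s)) (Z ∘ suc) (minor₀ L j) (minor-left j) (minor-right j)))
           (∑-zero λ w → trans (*-congʳ (trans (*-congˡ (trans (combine (suc r ↑ʳ w)) (right zero w))) (zeroʳ _))) (zeroˡ _)) ⟩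
    ∑ (λ j → sign K (toℕ j) * L zero j * (determinant (minor₀ L j) * determinant (block j))) + 0#
      ≈⟨ +-identityʳ _ ⟩
    ∑ (λ j → sign K (toℕ j) * L zero j * (determinant (minor₀ L j) * determinant (block j)))
      ≈⟨ ∑-cong (λ j → trans (sym (*-assoc _ _ _)) (*-congˡ (determinant-cong λ v w →
           reflexive (≡.cong (M (suc r ↑ʳ v)) (punchIn-↑ˡ-↑ʳ j w))))) ⟩
    ∑ (λ j → sign K (toℕ j) * L zero j * determinant (minor₀ L j) * determinant D)
      ≈⟨ *-distribʳ-∑ _ _ ⟨
    ∑ (λ j → sign K (toℕ j) * L zero j * determinant (minor₀ L j)) * determinant D
      ≈⟨ *-congʳ (expand-row L) ⟨
    determinant L * determinant D ∎
    where
    σ : Fin (suc r +ᴺ s) → Carrier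
    σ j = sign K (toℕ j)
    D : Matrix K s s
    D v w = M (suc r ↑ʳ v) (suc r ↑ʳ w)
    block : Fin (suc r) → Matrix K s s
    block j v w = minor₀ M (j ↑ˡ s) (r ↑ʳ v) (r ↑ʳ w)
    -- The 1 keeps row 0, the padding skips the other top rows, and `Z zero` weights the bottom
    -- rows.
    κ : Vector Carrier (suc r +ᴺ s)
    κ = 1# ∷ padˡ r (Z zero)
    M′ : Matrix K (suc r +ᴺ s) (suc r +ᴺ s)
    M′ = replaceRow zero (λ k → ∑ λ l → κ l * M l k) M
    combine : ∀ k → ∑ (λ l → κ l * M l k) ≈ M zero k + ∑ (λ w → Z zero w * M (suc r ↑ʳ w) k)
    combine k = trans (∑-suc _) (+-cong (*-identityˡ _) (∑-padˡ r (Z zero) (λ l → M (suc l) k)))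
    minor-left : ∀ j i c → minor₀ M (j ↑ˡ s) (i ↑ˡ s) (c ↑ˡ s) +
      ∑ (λ w → Z (suc i) w * minor₀ M (j ↑ˡ s) (r ↑ʳ w) (c ↑ˡ s)) ≈ minor₀ L j i c
    minor-left j i c rewrite punchIn-↑ˡ-↑ˡ j c s = left (suc i) (punchIn j c)
    minor-right : ∀ j i v → minor₀ M (j ↑ˡ s) (i ↑ˡ s) (r ↑ʳ v) +
      ∑ (λ w → Z (suc i) w * minor₀ M (j ↑ˡ s) (r ↑ʳ w) (r ↑ʳ v)) ≈ 0#
    minor-right j i v rewrite punchIn-↑ˡ-↑ʳ j v = right (suc i) v

  private
    -- Rows are treated one at a time. Since `G` is arbitrary, a finished row can be frozen inside
    -- it, which allows induction on the number of rows at a fixed row length.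
    add-multiples : ∀ {r} (G : Matrix K r n → Carrier) (v : Vector Carrier n) →
      (∀ {N N′} → N ≈ᴹ N′ → G N ≈ G N′) →
      (∀ a N x → G (replaceRow a (λ k → N a k + x * v k) N) ≈ G N) →
      ∀ N (x : Vector Carrier r) → G (λ l k → N l k + x l * v k) ≈ G N
    add-multiples {r = zero}  G v G-cong step N x = G-cong λ ()
    add-multiples {n} {r = suc r} G v G-cong step N x = begin
      G (λ l k → N l k + x l * v k)
        ≈⟨ G-cong (λ { zero _ → refl ; (suc _) _ → refl }) ⟩
      G (replaceRow zero (λ k → N zero k + x zero * v k) N′)
        ≈⟨ step zero N′ (x zero) ⟩
      G N′
        ≈⟨ add-multiples (λ N″ → G (N zero ∷ N″)) v
             (λ eq → G-cong λ { zero _ → refl ; (suc l) → eq l })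
             (λ a N″ y → trans (G-cong λ { zero _ → refl ; (suc _) _ → refl }) (step (suc a) (N zero ∷ N″) y))
             (N ∘ suc) (x ∘ suc) ⟩
      G (N zero ∷ N ∘ suc)
        ≈⟨ G-cong (λ { zero _ → refl ; (suc _) _ → refl }) ⟩
      G N ∎
      where
      N′ : Matrix K (suc r) n
      N′ = N zero ∷ λ l k → N (suc l) k + x (suc l) * v k

  determinant-add-row₀ : ∀ (v : Vector Carrier (suc n)) (N : Matrix K n (suc n)) (x : Vector Carrier n) →
    determinant (v ∷ λ l k → N l k + x l * v k) ≈ determinant (v ∷ N)
  determinant-add-row₀ v N x = add-multiples (λ N → determinant (v ∷ N)) v
    (λ eq → determinant-cong λ { zero _ → refl ; (suc l) → eq l }) step N x
    where
    step : ∀ a N y → determinant (v ∷ replaceRow a (λ k → N a k + y * v k) N) ≈ determinant (v ∷ N)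
    step a N y = begin
      determinant (v ∷ replaceRow a (λ k → N a k + y * v k) N)
        ≈⟨ determinant-cong (λ { zero _ → refl ; (suc l) k → replaceRow-cong a N (λ k → combine k) l k }) ⟩
      determinant (replaceRow (suc a) (λ k → ∑ λ l → (y ∷ δ a) l * (v ∷ N) l k) (v ∷ N))
        ≈⟨ determinant-replaceRow (suc a) (y ∷ δ a) (v ∷ N) ⟩
      δ a a * determinant (v ∷ N)
        ≈⟨ trans (*-congʳ (reflexive (δ-≡ a a ≡.refl))) (*-identityˡ _) ⟩
      determinant (v ∷ N) ∎
      where
      combine : ∀ k → N a k + y * v k ≈ ∑ λ l → (y ∷ δ a) l * (v ∷ N) l k
      combine k = trans (+-comm _ _) (sym (trans (∑-suc _) (+-congˡ (∑-δ a (λ l → N l k)))))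
      replaceRow-cong : ∀ {r s} (a : Fin r) (N : Matrix K r s) {u v : Vector Carrier s} → (∀ k → u k ≈ v k) →
        replaceRow a u N ≈ᴹ replaceRow a v N
      replaceRow-cong zero    N eq zero    = eq
      replaceRow-cong zero    N eq (suc l) = λ _ → refl
      replaceRow-cong (suc a) N eq zero    = λ _ → refl
      replaceRow-cong (suc a) N eq (suc l) = replaceRow-cong a (N ∘ suc) eq l

  -- A matrix of determinant `u`, given by its action on vectors. `scales` records multiplicativity
  -- for this one matrix, in place of a general product formula for determinants.
  record RowOperation (T : Vector Carrier r → Vector Carrier r) (u : Carrier) : Set (c ⊔ ℓ₁) where
    field
      cong        : ∀ {x y} → (∀ l → x l ≈ y l) → ∀ i → T x i ≈ T y i
      linear      : ∀ {m} (a : Vector Carrier m) (x : Matrix K m r) i →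
                    T (λ l → ∑ λ e → a e * x e l) i ≈ ∑ λ e → a e * T (x e) i
      scales      : ∀ M → determinant (λ i j → T (λ l → M l j) i) ≈ u * determinant M

  -- With the rows `β e` forming B, this is Bᵀ diag(a) B. The reduced Laplacians have this form, so
  -- a change of vertex coordinates acts on the edge vectors.
  gram : Vector Carrier m → Matrix K m r → Matrix K r r
  gram a β i j = ∑ λ e → a e * (β e i * β e j)

  -- The operation acts on both indices: `scales` is applied to one side, the half-transformed
  -- matrix `M` is transposed, and `scales` is applied again.
  determinant-gram-operation : ∀ {T : Vector Carrier r → Vector Carrier r} {u} → RowOperation T u →
    ∀ (a : Vector Carrier m) β → determinant (gram a (T ∘ β)) ≈ u * (u * determinant (gram a β))
  determinant-gram-operation {T = T} {u} op a β = begin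
    determinant (gram a (T ∘ β))
      ≈⟨ determinant-cong (λ i j → trans
           (∑-cong λ e → trans (*-congˡ (*-comm _ _)) (sym (*-assoc (a e) _ _)))
           (sym (linear (λ e → a e * T (β e) j) β i))) ⟩
    determinant (λ i j → T (λ l → M l j) i)
      ≈⟨ scales M ⟩
    u * determinant M
      ≈⟨ *-congˡ (determinant-transpose M) ⟨
    u * determinant (λ j l → M l j)
      ≈⟨ *-congˡ (determinant-cong λ j l → trans
           (∑-cong λ e → xy∙z≈xz∙y (a e) _ _)
           (sym (linear (λ e → a e * β e l) β j))) ⟩
    u * determinant (λ j l → T (λ l′ → ∑ λ e → (a e * β e l) * β e l′) j)
      ≈⟨ *-congˡ (scales _) ⟩
    u * (u * determinant (λ l′ l → ∑ λ e → (a e * β e l) * β e l′))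
      ≈⟨ *-congˡ (*-congˡ (determinant-cong λ i j → ∑-cong λ e →
           trans (*-assoc _ _ _) (*-congˡ (*-comm _ _)))) ⟩
    u * (u * determinant (gram a β)) ∎
    where
    open RowOperation op
    M : Matrix K _ _
    M l j = ∑ λ e → (a e * T (β e) j) * β e l

  replaceEntry : Fin r → Vector Carrier r → Vector Carrier r → Vector Carrier r
  replaceEntry a κ x = updateAt x a (const (∑ λ l → κ l * x l))

  replaceEntry-operation : ∀ (a : Fin r) κ → RowOperation (replaceEntry a κ) (κ a)
  replaceEntry-operation {r} a κ = record
    { cong   = λ eq → updateAt-cong a eq (∑-cong λ l → *-congˡ (eq l))
    ; linear = λ b x i → trans
        (updateAt-cong a (λ _ → refl) (trans
          (trans (∑-cong λ l → *-distribˡ-∑ (κ l) _) (∑-comm _))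
          (∑-cong λ e → trans (∑-cong λ l → x∙yz≈y∙xz (κ l) (b e) (x e l)) (sym (*-distribˡ-∑ (b e) _)))) i)
        (updateAt-∑ a b x _ i)
    ; scales = λ M → trans (determinant-cong (column a M _)) (determinant-replaceRow a κ M)
    }
    where
    updateAt-cong : ∀ {r} (a : Fin r) {x y : Vector Carrier r} {u v} → (∀ l → x l ≈ y l) → u ≈ v →
      ∀ i → updateAt x a (const u) i ≈ updateAt y a (const v) i
    updateAt-cong zero    eq u≈v zero    = u≈v
    updateAt-cong zero    eq u≈v (suc i) = eq (suc i)
    updateAt-cong (suc a) eq u≈v zero    = eq zero
    updateAt-cong (suc a) eq u≈v (suc i) = updateAt-cong a (eq ∘ suc) u≈v i
    updateAt-∑ : ∀ {r m} (a : Fin r) (b : Vector Carrier m) (x : Matrix K m r) (v : Vector Carrier m) i →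
      updateAt (λ l → ∑ λ e → b e * x e l) a (const (∑ λ e → b e * v e)) i ≈
      ∑ λ e → b e * updateAt (x e) a (const (v e)) i
    updateAt-∑ zero    b x v zero    = refl
    updateAt-∑ zero    b x v (suc i) = refl
    updateAt-∑ (suc a) b x v zero    = refl
    updateAt-∑ (suc a) b x v (suc i) = updateAt-∑ a b (λ e → x e ∘ suc) v i
    column : ∀ {r s} (a : Fin r) (M : Matrix K r s) (v : Vector Carrier s) →
      (λ i j → updateAt (λ l → M l j) a (const (v j)) i) ≈ᴹ replaceRow a v M
    column zero    M v zero    j = refl
    column zero    M v (suc i) j = refl
    column (suc a) M v zero    j = refl
    column (suc a) M v (suc i) j = column a (M ∘ suc) v i j

  -- The map (y , z) ↦ (y , z + κ y), built from successive additions of multiples of one coordinate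
  -- so that `determinant-add-row₀` yields determinant 1.
  shear : ∀ r → Matrix K s r → Vector Carrier (r +ᴺ s) → Vector Carrier (r +ᴺ s)
  shear zero    κ x         = x
  shear (suc r) κ x zero    = x zero
  shear (suc r) κ x (suc l) =
    shear r (λ w → κ w ∘ suc) (x ∘ suc) l + padˡ r (λ w → κ w zero) l * x zero

  shear-↑ˡ : ∀ r (κ : Matrix K s r) x i → shear r κ x (i ↑ˡ s) ≈ x (i ↑ˡ s)
  shear-↑ˡ (suc r) κ x zero    = refl
  shear-↑ˡ (suc r) κ x (suc i) = trans
    (+-cong (shear-↑ˡ r _ (x ∘ suc) i) (trans (*-congʳ (reflexive (padˡ-↑ˡ r _ i))) (zeroˡ _)))
    (+-identityʳ _)

  shear-↑ʳ : ∀ r (κ : Matrix K s r) x w → shear r κ x (r ↑ʳ w) ≈ x (r ↑ʳ w) + ∑ λ l → κ w l * x (l ↑ˡ s)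
  shear-↑ʳ zero    κ x w = sym (trans (+-congˡ (∑-empty _)) (+-identityʳ _))
  shear-↑ʳ (suc r) κ x w = trans
    (+-cong (shear-↑ʳ r _ (x ∘ suc) w) (*-congʳ (reflexive (padˡ-↑ʳ r _ w))))
    (trans (+-assoc _ _ _) (+-congˡ (trans (+-comm _ _) (sym (∑-suc _)))))

  shear-operation : ∀ r (κ : Matrix K s r) → RowOperation (shear r κ) 1#
  shear-operation {s} r κ = record { cong = shear-cong r κ ; linear = shear-linear r κ ; scales = scales r κ }
    where
    shear-cong : ∀ r (κ : Matrix K s r) {x y} → (∀ l → x l ≈ y l) → ∀ i → shear r κ x i ≈ shear r κ y i
    shear-cong zero    κ eq i       = eq i
    shear-cong (suc r) κ eq zero    = eq zero
    shear-cong (suc r) κ eq (suc i) = +-cong (shear-cong r _ (eq ∘ suc) i) (*-congˡ (eq zero))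
    shear-linear : ∀ r (κ : Matrix K s r) {m} (a : Vector Carrier m) (x : Matrix K m (r +ᴺ s)) i →
      shear r κ (λ l → ∑ λ e → a e * x e l) i ≈ ∑ λ e → a e * shear r κ (x e) i
    shear-linear zero    κ a x i       = refl
    shear-linear (suc r) κ a x zero    = refl
    shear-linear (suc r) κ a x (suc i) = begin
      shear r _ (λ l → ∑ λ e → a e * x e (suc l)) i + k * ∑ (λ e → a e * x e zero)
        ≈⟨ +-cong (shear-linear r _ a (λ e → x e ∘ suc) i)
             (trans (*-distribˡ-∑ k _) (∑-cong λ e → x∙yz≈y∙xz k (a e) _)) ⟩
      ∑ (λ e → a e * shear r _ (x e ∘ suc) i) + ∑ (λ e → a e * (k * x e zero))
        ≈⟨ ∑-distrib-+ _ _ ⟨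
      ∑ (λ e → a e * shear r _ (x e ∘ suc) i + a e * (k * x e zero))
        ≈⟨ ∑-cong (λ e → distribˡ _ _ _) ⟨
      ∑ (λ e → a e * (shear r _ (x e ∘ suc) i + k * x e zero)) ∎
      where
      k : Carrier
      k = padˡ r (λ w → κ w zero) i
    scales : ∀ r (κ : Matrix K s r) M → determinant (λ i j → shear r κ (λ l → M l j) i) ≈ 1# * determinant M
    scales zero    κ M = sym (*-identityˡ _)
    scales (suc r) κ M = trans (begin
      determinant (λ i j → shear (suc r) κ (λ l → M l j) i)
        ≈⟨ determinant-cong (λ { zero _ → refl ; (suc _) _ → refl }) ⟩
      determinant (M zero ∷ λ l k → N l k + padˡ r (λ w → κ w zero) l * M zero k)
        ≈⟨ determinant-add-row₀ (M zero) N _ ⟩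
      determinant (M zero ∷ N)
        ≈⟨ expand-row _ ⟩
      ∑ (λ j → sign K (toℕ j) * M zero j * determinant (λ i k → shear r _ (λ l → minor₀ M j l k) i))
        ≈⟨ ∑-cong (λ j → *-congˡ (trans (scales r _ (minor₀ M j)) (*-identityˡ _))) ⟩
      ∑ (λ j → sign K (toℕ j) * M zero j * determinant (minor₀ M j))
        ≈⟨ expand-row M ⟨
      determinant M ∎) (sym (*-identityˡ _))
      where
      N : Matrix K (r +ᴺ s) (suc r +ᴺ s)
      N l k = shear r (λ w → κ w ∘ suc) (λ l → M (suc l) k) l

-- Weighted matrix-tree theorem

module MatrixTree {c ℓ₁ ℓ₂} (K : OrderedField c ℓ₁ ℓ₂) where
  open LinearAlgebra K

  edgeVectors : (Fin n → Vector Carrier r) → (s t : Fin m → Fin n) → Matrix K m r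
  edgeVectors X s t e i = X (s e) i - X (t e) i

  -- The ground label goes to the zero vector; this is what removes the ground row and column from
  -- the Laplacian.
  labelVector : (Fin n → Fin (suc r)) → Fin n → Vector Carrier r
  labelVector f v i = δ (f v) (suc i)

  reducedLaplacian : Vector Carrier m → (s t : Fin m → Fin n) → (Fin n → Fin (suc r)) → Matrix K r r
  reducedLaplacian a s t f = gram a (edgeVectors (labelVector f) s t)

  gram-cong : ∀ (a : Vector Carrier m) {β γ : Matrix K m r} → β ≈ᴹ γ → gram a β ≈ᴹ gram a γ
  gram-cong a β≈γ i j = ∑-cong λ e → *-congˡ (*-cong (β≈γ e i) (β≈γ e j))

  reducedLaplacian-cong : ∀ (a : Vector Carrier m) (s t : Fin m → Fin n) {X Y : Fin n → Vector Carrier r} →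
    (∀ v i → X v i ≈ Y v i) → gram a (edgeVectors X s t) ≈ᴹ gram a (edgeVectors Y s t)
  reducedLaplacian-cong a s t X≈Y = gram-cong a λ e i → +-cong (X≈Y (s e) i) (-‿cong (X≈Y (t e) i))

  ∑-difference : (x y : Vector Carrier n) → ∑ (λ i → x i - y i) ≈ ∑ x - ∑ y
  ∑-difference x y = trans (∑-distrib-+ x _) (+-congˡ (∑-neg y))

  -- Exchanging the ground label 0 with another label b replaces the b-th
  -- coordinate by minus the sum of all coordinates, up to a translation.
  determinant-swap₀ : ∀ (a : Vector Carrier m) (s t : Fin m → Fin n) (f : Fin n → Fin (suc r)) b →
    determinant (reducedLaplacian a s t (swap₀ b ∘ f)) ≈ determinant (reducedLaplacian a s t f)
  determinant-swap₀ {r = r} a s t f b = begin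
    determinant (reducedLaplacian a s t (swap₀ b ∘ f))
      ≈⟨ determinant-cong (gram-cong a coordinates) ⟩
    determinant (gram a (replaceEntry b (const (- 1#)) ∘ edgeVectors (labelVector f) s t))
      ≈⟨ determinant-gram-operation (replaceEntry-operation b (const (- 1#))) a _ ⟩
    - 1# * (- 1# * determinant (reducedLaplacian a s t f))
      ≈⟨ trans (-1*x≈-x _) (trans (-‿cong (-1*x≈-x _)) (-‿involutive _)) ⟩
    determinant (reducedLaplacian a s t f) ∎
    where
    -- After the swap, coordinate `b` indicates the old ground label, and the indicators of all
    -- labels add up to 1.
    total : ∀ y → δ (swap₀ b y) (suc b) + ∑ (λ l → δ y (suc l)) ≈ 1#
    total zero    = trans (+-cong (reflexive (δ-≡ (suc b) (suc b) ≡.refl)) (∑-zero λ _ → refl)) (+-identityʳ _)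
    total (suc j) = trans (+-cong first second) (+-identityˡ _)
      where
      first : δ (swap₀ b (suc j)) (suc b) ≈ 0#
      first with j ≟ᶠ b
      ... | yes _   = refl
      ... | no  j≢b = reflexive (δ-≢ (suc j) (suc b) λ { ≡.refl → j≢b ≡.refl })
      second : ∑ (λ l → δ (suc j) (suc l)) ≈ 1#
      second = trans (∑-cong λ l → sym (*-identityʳ (δ j l))) (∑-δ j (const 1#))
    S : Fin _ → Carrier
    S v = ∑ (labelVector f v)
    x≈1-S : ∀ v → labelVector (swap₀ b ∘ f) v b ≈ 1# - S v
    x≈1-S v = begin
      x                  ≈⟨ trans (+-congˡ (-‿inverseʳ (S v))) (+-identityʳ x) ⟨
      x + (S v - S v)    ≈⟨ +-assoc x (S v) (- S v) ⟨
      x + S v - S v      ≈⟨ +-congʳ (total (f v)) ⟩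
      1# - S v           ∎
      where x = labelVector (swap₀ b ∘ f) v b
    off : ∀ v i → i ≢ b → labelVector (swap₀ b ∘ f) v i ≈ labelVector f v i
    off v i i≢b with f v
    ... | zero  = reflexive (δ-≢ (suc b) (suc i) λ { ≡.refl → i≢b ≡.refl })
    ... | suc j with j ≟ᶠ b
    ...   | yes ≡.refl = sym (reflexive (δ-≢ (suc b) (suc i) λ { ≡.refl → i≢b ≡.refl }))
    ...   | no  _      = refl
    coordinates : edgeVectors (labelVector (swap₀ b ∘ f)) s t ≈ᴹ
                  replaceEntry b (const (- 1#)) ∘ edgeVectors (labelVector f) s t
    coordinates e i with i ≟ᶠ b
    ... | no i≢b = trans (+-cong (off (s e) i i≢b) (-‿cong (off (t e) i i≢b)))
                     (reflexive (≡.sym (updateAt-minimal i b (edgeVectors (labelVector f) s t e) i≢b)))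
    ... | yes ≡.refl = begin
      labelVector (swap₀ b ∘ f) (s e) b - labelVector (swap₀ b ∘ f) (t e) b
        ≈⟨ +-cong (x≈1-S (s e)) (-‿cong (x≈1-S (t e))) ⟩
      (1# - S (s e)) - (1# - S (t e))
        ≈⟨ cancel (S (s e)) (S (t e)) ⟩
      - (S (s e) - S (t e))
        ≈⟨ -‿cong (∑-difference _ _) ⟨
      - ∑ (λ l → edgeVectors (labelVector f) s t e l)
        ≈⟨ trans (sym (-1*x≈-x _)) (*-distribˡ-∑ (- 1#) _) ⟩
      ∑ (λ l → - 1# * edgeVectors (labelVector f) s t e l)
        ≈⟨ reflexive (updateAt-updates b (edgeVectors (labelVector f) s t e)) ⟨
      replaceEntry b (const (- 1#)) (edgeVectors (labelVector f) s t e) b ∎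
      where
      cancel : ∀ x y → (1# - x) - (1# - y) ≈ - (x - y)
      cancel x y = begin
        (1# - x) - (1# - y)      ≈⟨ +-congˡ (trans (sym (-‿+-comm 1# (- y))) (+-congˡ (-‿involutive y))) ⟩
        (1# - x) + (- 1# + y)    ≈⟨ +.x∙yz≈y∙xz (1# - x) (- 1#) y ⟩
        - 1# + ((1# - x) + y)    ≈⟨ +-congˡ (+-assoc 1# (- x) y) ⟩
        - 1# + (1# + (- x + y))  ≈⟨ +-assoc (- 1#) 1# (- x + y) ⟨
        - 1# + 1# + (- x + y)    ≈⟨ trans (+-congʳ (-‿inverseˡ 1#)) (+-identityˡ _) ⟩
        - x + y                  ≈⟨ +-congˡ (-‿involutive y) ⟨
        - x + - - y              ≈⟨ -‿+-comm x (- y) ⟩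
        - (x - y)                ∎

  determinant-⇝ : ∀ (a : Vector Carrier m) (s t : Fin m → Fin n) {f g : Fin n → Fin (suc r)} → f ⇝ g →
    determinant (reducedLaplacian a s t f) ≈ determinant (reducedLaplacian a s t g)
  determinant-⇝ a s t stop               = refl
  determinant-⇝ a s t (swap {g} b f⇝g) = trans (determinant-⇝ a s t f⇝g) (sym (determinant-swap₀ a s t g b))

  weightOf : Vector Carrier m → Subset m → Carrier
  weightOf a F = ∏ λ e → if does (e ∈? F) then a e else 1#

  ∑Subsets-cong : {f g : Subset m → Carrier} → (∀ F → f F ≈ g F) → ∑Subsets K f ≈ ∑Subsets K g
  ∑Subsets-cong {zero}  f≈g = f≈g Vec.[]
  ∑Subsets-cong {suc m} f≈g = +-cong (∑Subsets-cong λ F → f≈g (outside Vec.∷ F)) (∑Subsets-cong λ F → f≈g (inside Vec.∷ F))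

  ∑Subsets-zero : {f : Subset m → Carrier} → (∀ F → f F ≈ 0#) → ∑Subsets K f ≈ 0#
  ∑Subsets-zero {zero}  f≈0 = f≈0 Vec.[]
  ∑Subsets-zero {suc m} f≈0 = trans
    (+-cong (∑Subsets-zero λ F → f≈0 (outside Vec.∷ F)) (∑Subsets-zero λ F → f≈0 (inside Vec.∷ F)))
    (+-identityʳ _)

  ∑Subsets-* : ∀ x (f : Subset m → Carrier) → ∑Subsets K (λ F → x * f F) ≈ x * ∑Subsets K f
  ∑Subsets-* {zero}  x f = refl
  ∑Subsets-* {suc m} x f = trans
    (+-cong (∑Subsets-* x (λ F → f (outside Vec.∷ F))) (∑Subsets-* x (λ F → f (inside Vec.∷ F))))
    (sym (distribˡ x _ _))

  private
    if-* : ∀ b {x y} → (if b then x * y else 0#) ≈ x * (if b then y else 0#)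
    if-* true  = refl
    if-* false = sym (zeroʳ _)

    ∑Subsets-weight-suc : ∀ (a : Vector Carrier (suc m)) {P : Subset (suc m) → Set} (P? : ∀ F → Dec (P F)) →
      ∑Subsets[_] K P? (weightOf a) ≈
      ∑Subsets[_] K (P? ∘ (outside Vec.∷_)) (weightOf (a ∘ suc)) +
      a zero * ∑Subsets[_] K (P? ∘ (inside Vec.∷_)) (weightOf (a ∘ suc))
    ∑Subsets-weight-suc a P? = +-cong
      (∑Subsets-cong λ F → trans (if-* (does (P? (outside Vec.∷ F)))) (*-identityˡ _))
      (trans (∑Subsets-cong λ F → if-* (does (P? (inside Vec.∷ F))))
        (∑Subsets-* (a zero) (λ F → if does (P? (inside Vec.∷ F)) then weightOf (a ∘ suc) F else 0#)))

    gram-suc : ∀ (a : Vector Carrier (suc m)) (β : Matrix K (suc m) r) i j →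
      gram a β i j ≈ a zero * (β zero i * β zero j) + gram (a ∘ suc) (β ∘ suc) i j
    gram-suc a β i j = ∑-suc _

    determinant-add-corner : ∀ (N : Matrix K (suc r) (suc r)) (M : Matrix K (suc r) (suc r)) x →
      (∀ j → M zero j ≈ N zero j + x * δ zero j) → (∀ i j → M (suc i) j ≈ N (suc i) j) →
      determinant M ≈ determinant N + x * determinant (λ i j → N (suc i) (suc j))
    determinant-add-corner {r} N M x row₀ rows = begin
      determinant M
        ≈⟨ expand-row M ⟩
      ∑ (λ j → sign K (toℕ j) * M zero j * determinant (λ i k → M (suc i) (punchIn j k)))
        ≈⟨ ∑-cong (λ j → *-cong (*-congˡ (row₀ j)) (determinant-cong λ i k → rows i (punchIn j k))) ⟩
      ∑ (λ j → sign K (toℕ j) * (N zero j + x * δ zero j) * D j)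
        ≈⟨ ∑-cong (λ j → trans (*-congʳ (distribˡ _ _ _)) (trans (distribʳ _ _ _)
             (+-congˡ (trans (*-congʳ (trans (sym (*-assoc _ _ _)) (*-comm _ _))) (*-assoc _ _ _))))) ⟩
      ∑ (λ j → sign K (toℕ j) * N zero j * D j + δ zero j * (sign K (toℕ j) * x * D j))
        ≈⟨ ∑-distrib-+ _ _ ⟩
      ∑ (λ j → sign K (toℕ j) * N zero j * D j) + ∑ (λ j → δ zero j * (sign K (toℕ j) * x * D j))
        ≈⟨ +-cong (sym (expand-row N)) (trans (∑-δ zero (λ j → sign K (toℕ j) * x * D j)) (*-congʳ (*-identityˡ x))) ⟩
      determinant N + x * D zero ∎
      where
      D : Fin (suc r) → Carrier
      D j = determinant (λ i k → N (suc i) (punchIn j k))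

    collapse-labelVector : ∀ (g : Fin n → Fin (suc (suc r))) v i →
      labelVector g v (suc i) ≈ labelVector (collapse ∘ g) v i
    collapse-labelVector g v i with g v
    ... | zero  = refl
    ... | suc y = refl

  -- `P` is any decidable predicate equivalent to `Tree`, so that Φ and Ψ are reached with their own
  -- decision procedures. The induction removes the first edge: a loop has zero edge vector and lies
  -- in no tree, and any other edge splits the sum into deletion and contraction.
  matrix-tree : ∀ (a : Vector Carrier m) (s t : Fin m → Fin n) (f : Fin n → Fin (suc r)) → Surjective f →
    ∀ {P : Subset m → Set} (P? : ∀ F → Dec (P F)) → (∀ F → P F ⇔ Tree (Ker f) s t F) →
    determinant (reducedLaplacian a s t f) ≈ ∑Subsets[_] K P? (weightOf a)
  matrix-tree {zero} {r = zero} a s t f sur P? P⇔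
    rewrite dec-true (P? Vec.[]) (Equivalence.from (P⇔ Vec.[]) (tt , λ _ _ → one-label)) = determinant-empty _
  -- Without edges but with a label besides the ground, the first row is zero and `tree-size`
  -- excludes every tree.
  matrix-tree {zero} {r = suc r} a s t f sur P? P⇔
    rewrite dec-false (P? Vec.[]) (λ P → case tree-size f sur s t Vec.[] (Equivalence.to (P⇔ Vec.[]) P) of λ ()) =
    trans (expand-row _) (∑-zero λ j → trans (*-congʳ (trans (*-congˡ (∑-empty _)) (zeroʳ _))) (zeroˡ _))
  matrix-tree {suc m} {n} {r} a s t f sur {P} P? P⇔ with f (s zero) ≟ᶠ f (t zero)
  ... | yes fs≡ft = begin
    determinant (reducedLaplacian a s t f)
      ≈⟨ determinant-cong (λ i j → trans (gram-suc a βs i j)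
           (trans (+-congʳ (trans (*-congˡ (trans (*-congʳ (loop i)) (zeroˡ _))) (zeroʳ _))) (+-identityˡ _))) ⟩
    determinant (reducedLaplacian (a ∘ suc) (s ∘ suc) (t ∘ suc) f)
      ≈⟨ matrix-tree (a ∘ suc) (s ∘ suc) (t ∘ suc) f sur (P? ∘ (outside Vec.∷_)) (P⇔ ∘ (outside Vec.∷_)) ⟩
    deleted
      ≈⟨ trans (+-congˡ (trans (*-congˡ contracted≈0) (zeroʳ _))) (+-identityʳ _) ⟨
    deleted + a zero * contracted
      ≈⟨ ∑Subsets-weight-suc a P? ⟨
    ∑Subsets[_] K P? (weightOf a) ∎
    where
    deleted contracted : Carrier
    deleted = ∑Subsets[_] K (P? ∘ (outside Vec.∷_)) (weightOf (a ∘ suc))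
    contracted = ∑Subsets[_] K (P? ∘ (inside Vec.∷_)) (weightOf (a ∘ suc))
    βs : Matrix K (suc m) r
    βs = edgeVectors (labelVector f) s t
    loop : ∀ i → edgeVectors (labelVector f) s t zero i ≈ 0#
    loop i rewrite fs≡ft = -‿inverseʳ _
    contracted≈0 : contracted ≈ 0#
    contracted≈0 = ∑Subsets-zero λ F → reflexive (≡.cong (λ b → if b then weightOf (a ∘ suc) F else 0#)
      (dec-false (P? (inside Vec.∷ F)) λ p → proj₁ (proj₁ (Equivalence.to (P⇔ (inside Vec.∷ F)) p)) fs≡ft))
  matrix-tree {suc m} {n} {zero} a s t f sur {P} P? P⇔ | no fs≢ft = contradiction one-label fs≢ft
  -- Relabelled by g, edge 0 joins the ground to the vertex of the first row, so
  -- it contributes to the corner entry only.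
  matrix-tree {suc m} {n} {suc r} a s t f sur {P} P? P⇔ | no fs≢ft with g , f⇝g , gs , gt ← relabel f fs≢ft = begin
    determinant (reducedLaplacian a s t f)
      ≈⟨ determinant-⇝ a s t f⇝g ⟩
    determinant (reducedLaplacian a s t g)
      ≈⟨ determinant-add-corner N _ (a zero)
           (λ j → trans (gram-suc a βs zero j) (trans (+-comm _ _) (+-congˡ (*-congˡ (corner-row j)))))
           (λ i j → trans (gram-suc a βs (suc i) j) (trans (+-congʳ (trans (*-congˡ (corner-rows i j)) (zeroʳ _)))
             (+-identityˡ _))) ⟩
    determinant N + a zero * determinant (λ i j → N (suc i) (suc j))
      ≈⟨ +-cong
           (trans (sym (determinant-⇝ (a ∘ suc) (s ∘ suc) (t ∘ suc) f⇝g))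
             (matrix-tree (a ∘ suc) (s ∘ suc) (t ∘ suc) f sur (P? ∘ (outside Vec.∷_)) (P⇔ ∘ (outside Vec.∷_))))
           (*-congˡ (trans
             (determinant-cong (reducedLaplacian-cong (a ∘ suc) (s ∘ suc) (t ∘ suc) (collapse-labelVector g)))
             (matrix-tree (a ∘ suc) (s ∘ suc) (t ∘ suc) (collapse ∘ g) (collapse-surjective g gs gt (⇝-surjective f⇝g sur))
               (P? ∘ (inside Vec.∷_)) contraction))) ⟩
    deleted + a zero * contracted
      ≈⟨ ∑Subsets-weight-suc a P? ⟨
    ∑Subsets[_] K P? (weightOf a) ∎
    where
    deleted contracted : Carrier
    deleted = ∑Subsets[_] K (P? ∘ (outside Vec.∷_)) (weightOf (a ∘ suc))
    contracted = ∑Subsets[_] K (P? ∘ (inside Vec.∷_)) (weightOf (a ∘ suc))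
    N : Matrix K (suc r) (suc r)
    N = reducedLaplacian (a ∘ suc) (s ∘ suc) (t ∘ suc) g
    βs : Matrix K (suc m) (suc r)
    βs = edgeVectors (labelVector g) s t
    β : Vector Carrier (suc r)
    β = βs zero
    β≈ : ∀ i → β i ≈ - δ zero i
    β≈ i rewrite gs | gt = +-identityˡ _
    corner-row : ∀ j → β zero * β j ≈ δ zero j
    corner-row j = trans (*-cong (β≈ zero) (β≈ j)) (trans (-1*x≈-x _) (-‿involutive _))
    corner-rows : ∀ i j → β (suc i) * β j ≈ 0#
    corner-rows i j = trans (*-congʳ (trans (β≈ (suc i)) -0#≈0#)) (zeroˡ _)
    to-merge : Merge (Ker f) (s zero) (t zero) ⇒ Ker (collapse ∘ g)
    to-merge k = collapse-ker⇒ g gs gt (merge-mono {_∼_ = Ker f} {Ker g} (⇝-ker⇒ f⇝g) k)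
    from-merge : Ker (collapse ∘ g) ⇒ Merge (Ker f) (s zero) (t zero)
    from-merge k = merge-mono {_∼_ = Ker g} {Ker f} (⇝-ker⇐ f⇝g) (collapse-ker⇐ g gs gt k)
    contraction : ∀ F → P (inside Vec.∷ F) ⇔ Tree (Ker (collapse ∘ g)) (s ∘ suc) (t ∘ suc) F
    contraction F = mk⇔
      (λ p → let (_ , i) , tot = Equivalence.to (P⇔ (inside Vec.∷ F)) p in
        tree-resp to-merge from-merge _ _ F (i , tot))
      (λ T → let i , tot = tree-resp from-merge to-merge _ _ F T in
        Equivalence.from (P⇔ (inside Vec.∷ F)) ((fs≢ft , i) , tot))

  -- Positivity of weighted sums

  module _ where
    open IsStrictPartialOrder isStrictPartialOrder using (<-resp-≈) renaming (trans to <-trans)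

    <-respˡ : ∀ {x y z} → x ≈ y → x < z → y < z
    <-respˡ = proj₂ <-resp-≈

    <-respʳ : ∀ {x y z} → y ≈ z → x < y → x < z
    <-respʳ = proj₁ <-resp-≈

    -- Invertibility of 1 - 0 puts 1 on one side of 0. If it were below, - 1 would be positive and
    -- so would its square, which is 1.
    0<1 : 0# < 1#
    0<1 with Equivalence.to #⇔<⊎> (invertible⇒# {1#} {0#} (1# , 1*[1-0]≈1 , trans (*-comm _ _) 1*[1-0]≈1))
      where
      1*[1-0]≈1 : 1# * (1# - 0#) ≈ 1#
      1*[1-0]≈1 = trans (*-identityˡ _) (trans (+-congˡ -0#≈0#) (+-identityʳ _))
    ... | inj₂ 0<1 = 0<1
    ... | inj₁ 1<0 = <-respʳ (trans (-1*x≈-x _) (-‿involutive _)) (*-pos 0<-1 0<-1)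
      where
      0<-1 : 0# < - 1#
      0<-1 = <-respˡ (-‿inverseʳ 1#) (<-respʳ (+-identityˡ _) (+-monoˡ-< (- 1#) 1<0))

    +-pos : ∀ {x y} → 0# < x → 0# < y → 0# < x + y
    +-pos {x} {y} 0<x 0<y = <-trans 0<y (<-respˡ (+-identityˡ y) (+-monoˡ-< y 0<x))

  -- A disjunction, since each summand is known to be either a positive weight or the default 0; no
  -- comparison of field elements has to be decided.
  NonNegative : Carrier → Set (ℓ₁ ⊔ ℓ₂)
  NonNegative x = 0# < x ⊎ x ≈ 0#

  pos+nonNeg : ∀ {x y} → 0# < x → NonNegative y → 0# < x + y
  pos+nonNeg 0<x (inj₁ 0<y) = +-pos 0<x 0<y
  pos+nonNeg 0<x (inj₂ y≈0) = <-respʳ (sym (trans (+-congˡ y≈0) (+-identityʳ _))) 0<x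

  nonNeg+pos : ∀ {x y} → NonNegative x → 0# < y → 0# < x + y
  nonNeg+pos 0≤x 0<y = <-respʳ (+-comm _ _) (pos+nonNeg 0<y 0≤x)

  ∑Subsets-nonNeg : ∀ (f : Subset m → Carrier) → (∀ F → NonNegative (f F)) → NonNegative (∑Subsets K f)
  ∑Subsets-nonNeg {zero}  f f≥0 = f≥0 Vec.[]
  ∑Subsets-nonNeg {suc m} f f≥0
    with ∑Subsets-nonNeg _ (λ F → f≥0 (outside Vec.∷ F)) | ∑Subsets-nonNeg _ (λ F → f≥0 (inside Vec.∷ F))
  ... | inj₁ 0<x | 0≤y      = inj₁ (pos+nonNeg 0<x 0≤y)
  ... | inj₂ x≈0 | inj₁ 0<y = inj₁ (nonNeg+pos (inj₂ x≈0) 0<y)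
  ... | inj₂ x≈0 | inj₂ y≈0 = inj₂ (trans (+-cong x≈0 y≈0) (+-identityʳ _))

  ∑Subsets-pos : ∀ (f : Subset m → Carrier) → (∀ F → NonNegative (f F)) → ∀ F → 0# < f F → 0# < ∑Subsets K f
  ∑Subsets-pos f f≥0 Vec.[]            0<fF = 0<fF
  ∑Subsets-pos f f≥0 (outside Vec.∷ F) 0<fF =
    pos+nonNeg (∑Subsets-pos _ (λ F → f≥0 (outside Vec.∷ F)) F 0<fF) (∑Subsets-nonNeg _ λ F → f≥0 (inside Vec.∷ F))
  ∑Subsets-pos f f≥0 (inside  Vec.∷ F) 0<fF =
    nonNeg+pos (∑Subsets-nonNeg _ λ F → f≥0 (outside Vec.∷ F)) (∑Subsets-pos _ (λ F → f≥0 (inside Vec.∷ F)) F 0<fF)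

  ∏-pos : ∀ (x : Vector Carrier m) → (∀ e → 0# < x e) → 0# < ∏ x
  ∏-pos {zero}  x 0<x = 0<1
  ∏-pos {suc m} x 0<x = *-pos (0<x zero) (∏-pos (x ∘ suc) (0<x ∘ suc))

  weightOf-pos : ∀ (a : Vector Carrier m) → (∀ e → 0# < a e) → ∀ F → 0# < weightOf a F
  weightOf-pos a 0<a F = ∏-pos _ λ e → if-pos (does (e ∈? F)) (0<a e)
    where
    if-pos : ∀ b {x} → 0# < x → 0# < (if b then x else 1#)
    if-pos true  0<x = 0<x
    if-pos false 0<x = 0<1

  ∑Subsets-weight-pos : ∀ (a : Vector Carrier m) → (∀ e → 0# < a e) →
    ∀ {P : Subset m → Set} (P? : ∀ F → Dec (P F)) → ∃ P → 0# < ∑Subsets[_] K P? (weightOf a)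
  ∑Subsets-weight-pos a 0<a P? (F , p) = ∑Subsets-pos _ nonNeg F positive
    where
    nonNeg : ∀ F → NonNegative (if does (P? F) then weightOf a F else 0#)
    nonNeg F with does (P? F)
    ... | true  = inj₁ (weightOf-pos a 0<a F)
    ... | false = inj₂ refl
    positive : 0# < (if does (P? F) then weightOf a F else 0#)
    positive rewrite dec-true (P? F) p = weightOf-pos a 0<a F

-- From the superport response to the reduced Laplacians

module ResponseMatrix {c ℓ₁ ℓ₂} (K : OrderedField c ℓ₁ ℓ₂)
  {n m p q} (G : SimpleGraph n m) (cond : Fin m → OrderedField.Carrier K) (S : Superports n p q) where
  open LinearAlgebra K
  open MatrixTree K
  open SimpleGraph G
  open Superports S
  open PortLabels S

  private
    incidence : Fin m → Fin n → Carrier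
    incidence e u = δ (src e) u - δ (tgt e) u

    flip-sign : (0# - 1#) * (1# - 0#) ≈ - 1#
    flip-sign = trans (*-cong (+-identityˡ _) (trans (+-congˡ -0#≈0#) (+-identityʳ _))) (*-identityʳ _)

    incidence² : ∀ e u → incidence e u * incidence e u ≈ (if does ((src e ≟ᶠ u) ⊎-dec (tgt e ≟ᶠ u)) then 1# else 0#)
    incidence² e u with src e ≟ᶠ u | tgt e ≟ᶠ u
    ... | yes s | yes t = contradiction (≡.trans s (≡.sym t)) (noLoops e)
    ... | yes _ | no _  = trans (*-cong 1-0 1-0) (*-identityˡ _)
      where 1-0 = trans (+-congˡ -0#≈0#) (+-identityʳ 1#)
    ... | no _  | yes _ = trans (*-cong (+-identityˡ _) (+-identityˡ _)) (trans (-1*x≈-x _) (-‿involutive _))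
    ... | no _  | no _  = trans (*-congʳ (-‿inverseʳ 0#)) (zeroˡ _)

    incidence-joined : ∀ e {u v} → u ≢ v → Joins multigraph e u v → incidence e u * incidence e v ≈ - 1#
    incidence-joined e {u} {v} u≢v (inj₁ (≡.refl , ≡.refl)) = trans (*-cong
      (+-cong (reflexive (δ-≡ u u ≡.refl)) (-‿cong (reflexive (δ-≢ v u (u≢v ∘ ≡.sym)))))
      (+-cong (reflexive (δ-≢ u v u≢v)) (-‿cong (reflexive (δ-≡ v v ≡.refl))))) (trans (*-comm _ _) flip-sign)
    incidence-joined e {u} {v} u≢v (inj₂ (≡.refl , ≡.refl)) = trans (*-cong
      (+-cong (reflexive (δ-≢ v u (u≢v ∘ ≡.sym))) (-‿cong (reflexive (δ-≡ u u ≡.refl))))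
      (+-cong (reflexive (δ-≡ v v ≡.refl)) (-‿cong (reflexive (δ-≢ u v u≢v))))) flip-sign

    incidence-off : ∀ e {u} → src e ≢ u → tgt e ≢ u → incidence e u ≈ 0#
    incidence-off e s≢u t≢u =
      trans (+-cong (reflexive (δ-≢ _ _ s≢u)) (-‿cong (reflexive (δ-≢ _ _ t≢u)))) (-‿inverseʳ 0#)

    incidence-unjoined : ∀ e {u v} → u ≢ v → ¬ Joins multigraph e u v → incidence e u * incidence e v ≈ 0#
    incidence-unjoined e {u} {v} u≢v ¬joins with src e ≟ᶠ u | tgt e ≟ᶠ u
    ... | no s≢u | no t≢u = trans (*-congʳ (-‿inverseʳ 0#)) (zeroˡ _)
    ... | yes s | _ = trans (*-congˡ (incidence-off e (λ s′ → u≢v (≡.trans (≡.sym s) s′)) (λ t′ → ¬joins (inj₁ (s , t′))))) (zeroʳ _)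
    ... | _ | yes t = trans (*-congˡ (incidence-off e (λ s′ → ¬joins (inj₂ (s′ , t))) (λ t′ → u≢v (≡.trans (≡.sym t) t′)))) (zeroʳ _)

    if-*1 : ∀ b x → (if b then x else 0#) ≈ x * (if b then 1# else 0#)
    if-*1 true  x = sym (*-identityʳ x)
    if-*1 false x = sym (zeroʳ x)

  -- On the diagonal `noLoops` makes each squared incidence 0 or 1; off the diagonal `noParallel`
  -- leaves at most one edge in the sum.
  laplacian≈∑ : ∀ u v → laplacian K G cond u v ≈ ∑ λ e → cond e * (incidence e u * incidence e v)
  laplacian≈∑ u v with u ≟ᶠ v
  ... | yes ≡.refl = trans (reflexive (≡.sym (∑-def _)))
    (∑-cong λ e → trans (if-*1 (does ((src e ≟ᶠ u) ⊎-dec (tgt e ≟ᶠ u))) (cond e)) (*-congˡ (sym (incidence² e u))))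
  ... | no u≢v with any? (λ e → joins? multigraph e u v)
  ...   | yes (e , j) = sym (trans
    (∑-single e λ f f≢e → trans (*-congˡ (incidence-unjoined f u≢v λ j′ → f≢e (noParallel j′ j))) (zeroʳ _))
    (trans (*-congˡ (incidence-joined e u≢v j)) (trans (*-comm _ _) (-1*x≈-x _))))
  ...   | no ¬joined = sym (∑-zero λ e → trans (*-congˡ (incidence-unjoined e u≢v λ j → ¬joined (e , j))) (zeroʳ _))

  ∑-incidence : ∀ e (x : Vector Carrier n) → ∑ (λ u → x u * incidence e u) ≈ x (src e) - x (tgt e)
  ∑-incidence e x = begin
    ∑ (λ u → x u * incidence e u)
      ≈⟨ ∑-cong (λ u → trans (*-comm _ _) (trans (distribʳ _ _ _) (+-congˡ (sym (-‿distribˡ-* _ _))))) ⟩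
    ∑ (λ u → δ (src e) u * x u - δ (tgt e) u * x u)
      ≈⟨ ∑-difference _ _ ⟩
    ∑ (λ u → δ (src e) u * x u) - ∑ (λ u → δ (tgt e) u * x u)
      ≈⟨ +-cong (∑-δ (src e) x) (-‿cong (∑-δ (tgt e) x)) ⟩
    x (src e) - x (tgt e) ∎

  current : Vector Carrier n → Vector Carrier n
  current U = _·_ K (laplacian K G cond) U

  current≈∑ : ∀ U v → current U v ≈ ∑ λ e → cond e * (incidence e v * (U (src e) - U (tgt e)))
  current≈∑ U v = begin
    current U v
      ≈⟨ reflexive (≡.sym (∑-def _)) ⟩
    ∑ (λ u → laplacian K G cond v u * U u)
      ≈⟨ ∑-cong (λ u → trans (*-comm _ _) (*-congˡ (laplacian≈∑ v u))) ⟩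
    ∑ (λ u → U u * ∑ (λ e → cond e * (incidence e v * incidence e u)))
      ≈⟨ ∑-exchange U cond (λ e u → incidence e v * incidence e u) ⟩
    ∑ (λ e → cond e * ∑ (λ u → U u * (incidence e v * incidence e u)))
      ≈⟨ ∑-cong (λ e → *-congˡ (trans (∑-cong λ u → x∙yz≈y∙xz (U u) _ _)
           (trans (sym (*-distribˡ-∑ (incidence e v) (λ u → U u * incidence e u))) (*-congˡ (∑-incidence e U))))) ⟩
    ∑ (λ e → cond e * (incidence e v * (U (src e) - U (tgt e)))) ∎

  -- Summation by parts: pairing the currents of `U` with a test vector gives the Dirichlet form.
  -- The test vectors will be the port coordinates.
  ∑-current : ∀ x U → ∑ (λ v → x v * current U v) ≈
                      ∑ λ e → cond e * ((x (src e) - x (tgt e)) * (U (src e) - U (tgt e)))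
  ∑-current x U = begin
    ∑ (λ v → x v * current U v)
      ≈⟨ ∑-cong (λ v → *-congˡ (current≈∑ U v)) ⟩
    ∑ (λ v → x v * ∑ (λ e → cond e * (incidence e v * D e)))
      ≈⟨ ∑-exchange x cond (λ e v → incidence e v * D e) ⟩
    ∑ (λ e → cond e * ∑ (λ v → x v * (incidence e v * D e)))
      ≈⟨ ∑-cong (λ e → *-congˡ (trans (∑-cong λ v → sym (*-assoc _ _ _))
           (trans (sym (*-distribʳ-∑ (D e) (λ v → x v * incidence e v))) (*-congʳ (∑-incidence e x))))) ⟩
    ∑ (λ e → cond e * ((x (src e) - x (tgt e)) * D e)) ∎
    where
    D : Fin m → Carrier
    D e = U (src e) - U (tgt e)

  -- Linearity is stated for finite combinations, so the difference is taken as the one with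
  -- coefficients 1 and - 1.
  operation-difference : ∀ {r} {T : Vector Carrier r → Vector Carrier r} {u} → RowOperation T u →
    ∀ x y i → T (λ l → x l - y l) i ≈ T x i - T y i
  operation-difference {T = T} op x y i = begin
    T (λ l → x l - y l) i
      ≈⟨ RowOperation.cong op (λ l → sym (two (λ e → (x ∷ y ∷ []) e l))) i ⟩
    T (λ l → ∑ λ e → (1# ∷ - 1# ∷ []) e * (x ∷ y ∷ []) e l) i
      ≈⟨ RowOperation.linear op (1# ∷ - 1# ∷ []) (x ∷ y ∷ []) i ⟩
    ∑ (λ e → (1# ∷ - 1# ∷ []) e * T ((x ∷ y ∷ []) e) i)
      ≈⟨ two (λ e → T ((x ∷ y ∷ []) e) i) ⟩
    T x i - T y i ∎
    where
    two : ∀ (z : Vector Carrier 2) → ∑ (λ e → (1# ∷ - 1# ∷ []) e * z e) ≈ z zero - z (suc zero)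
    two z = trans (∑-suc _) (+-cong (*-identityˡ _)
      (trans (∑-suc _) (trans (+-cong (-1*x≈-x _) (∑-empty _)) (+-identityʳ _))))

  module _ (I : Subset q) where

    private
      d : ℕ
      d = ∣ I ∣

    -- portVector v · (y , z) is the voltage at v when the class w has root
    -- voltage z w and the i-th port of I has voltage y i relative to its root.
    portVector : Fin n → Vector Carrier (d +ᴺ classRank)
    portVector v = (λ i → δ (freeNode I i) v) ++ labelVector classLabel v

    portVector-↑ˡ : ∀ v i → portVector v (i ↑ˡ classRank) ≈ δ (freeNode I i) v
    portVector-↑ˡ v i = reflexive (lookup-++ˡ (λ i → δ (freeNode I i) v) (labelVector classLabel v) i)

    portVector-↑ʳ : ∀ v w → portVector v (d ↑ʳ w) ≈ δ (classLabel v) (suc w)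
    portVector-↑ʳ v w = reflexive (lookup-++ʳ (λ i → δ (freeNode I i) v) (labelVector classLabel v) w)

    private
      incident : Matrix K classRank d
      incident w i = δ (classLabel (freeNode I i)) (suc w)

      δ-↑ˡ : ∀ (i j : Fin d) → δ (suc (i ↑ˡ classRank)) (suc (j ↑ˡ classRank)) ≈ δ i j
      δ-↑ˡ i j with i ≟ᶠ j
      ... | yes ≡.refl = reflexive (δ-≡ (i ↑ˡ classRank) _ ≡.refl)
      ... | no  i≢j    = reflexive (δ-≢ (i ↑ˡ classRank) (j ↑ˡ classRank) (i≢j ∘ ↑ˡ-injective classRank i j))

      δ-raise-↑ʳ : ∀ y w → δ (raise I y) (suc (d ↑ʳ w)) ≈ δ y (suc w)
      δ-raise-↑ʳ y w with y ≟ᶠ suc w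
      ... | yes ≡.refl = reflexive (δ-≡ (suc (d ↑ʳ w)) _ ≡.refl)
      ... | no  y≢w    = reflexive (δ-≢ (raise I y) (suc (d ↑ʳ w)) (y≢w ∘ raise-injective I {y} {suc w}))

      δ-raise-↑ˡ : ∀ y i → δ (raise I y) (suc (i ↑ˡ classRank)) ≈ 0#
      δ-raise-↑ˡ y i = reflexive (δ-≢ _ _ (raise≢free I y i))

      δ-↑ˡ-↑ʳ : ∀ (i : Fin d) w → δ (suc (i ↑ˡ classRank)) (suc (d ↑ʳ w)) ≈ 0#
      δ-↑ˡ-↑ʳ i w = reflexive (δ-≢ (suc (i ↑ˡ classRank)) (suc (d ↑ʳ w)) λ eq → raise≢free I (suc w) i (≡.sym eq))

    -- `freeLabel` sees a free node only as a class of its own, whereas `portVector` counts it in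
    -- its superport class as well. Adding the indicator of each free node to that of its class is
    -- the shear by `incident`.
    shear-labelVector : ∀ v l → shear d incident (labelVector (freeLabel I) v) l ≈ portVector v l
    shear-labelVector v l with splitAt d l in eq
    ... | inj₁ i rewrite ≡.sym (splitAt⁻¹-↑ˡ {i = l} eq) = trans (shear-↑ˡ d incident (labelVector (freeLabel I) v) i) (free v i)
      where
      free : ∀ v i → δ (freeLabel I v) (suc (i ↑ˡ classRank)) ≈ δ (freeNode I i) v
      free v i with isFree? I v
      ... | no ¬free = trans (δ-raise-↑ˡ (classLabel v) i) (sym (reflexive (δ-≢ (freeNode I i) v λ e → ¬free (i , e))))
      ... | yes (j , ≡.refl) with i ≟ᶠ j
      ...   | yes ≡.refl = trans (reflexive (δ-≡ (i ↑ˡ classRank) _ ≡.refl)) (sym (reflexive (δ-≡ (freeNode I i) _ ≡.refl)))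
      ...   | no  i≢j    = trans (reflexive (δ-≢ (j ↑ˡ classRank) (i ↑ˡ classRank) λ e → i≢j (≡.sym (↑ˡ-injective classRank j i e))))
                             (sym (reflexive (δ-≢ (freeNode I i) (freeNode I j) (i≢j ∘ freeNode-injective I))))
    ... | inj₂ w rewrite ≡.sym (splitAt⁻¹-↑ʳ {i = l} eq) = trans (shear-↑ʳ d incident (labelVector (freeLabel I) v) w) (fixed v)
      where
      fixed : ∀ v → δ (freeLabel I v) (suc (d ↑ʳ w)) + ∑ (λ i → incident w i * δ (freeLabel I v) (suc (i ↑ˡ classRank))) ≈
                    δ (classLabel v) (suc w)
      fixed v with isFree? I v
      ... | no ¬free = trans (+-cong (δ-raise-↑ʳ (classLabel v) w)
                               (∑-zero λ i → trans (*-congˡ (δ-raise-↑ˡ (classLabel v) i)) (zeroʳ _))) (+-identityʳ _)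
      ... | yes (j , ≡.refl) = trans (+-cong (δ-↑ˡ-↑ʳ j w)
                               (trans (∑-cong λ i → trans (*-congˡ (δ-↑ˡ j i)) (*-comm _ _)) (∑-δ j (incident w))))
                               (+-identityˡ _)

    determinant-portVector :
      determinant (gram cond (edgeVectors portVector src tgt)) ≈
      determinant (reducedLaplacian cond src tgt (freeLabel I))
    determinant-portVector = begin
      determinant (gram cond (edgeVectors portVector src tgt))
        ≈⟨ determinant-cong (gram-cong cond λ e l → sym (trans
             (operation-difference (shear-operation d incident) _ _ l)
             (+-cong (shear-labelVector (src e) l) (-‿cong (shear-labelVector (tgt e) l))))) ⟩
      determinant (gram cond (shear d incident ∘ edgeVectors (labelVector (freeLabel I)) src tgt))
        ≈⟨ determinant-gram-operation (shear-operation d incident) cond _ ⟩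
      1# * (1# * determinant (reducedLaplacian cond src tgt (freeLabel I)))
        ≈⟨ trans (*-identityˡ _) (*-identityˡ _) ⟩
      determinant (reducedLaplacian cond src tgt (freeLabel I)) ∎

  module _ (L : Matrix K q q) (response : IsResponseMatrix K G cond S L) where

    private
      unitVoltages : Fin q → Vector Carrier n
      unitVoltages x = proj₁ (proj₁ (response (δ x)))

      admissible : ∀ x → Admissible K G cond S (δ x) (unitVoltages x)
      admissible x = proj₂ (proj₁ (response (δ x)))

      -- Class voltages relative to the ground class; these become the multipliers `Z` of the block
      -- elimination.
      potential : Fin q → Vector Carrier classRank
      potential x w = unitVoltages x (representative (suc w)) - unitVoltages x (representative zero)

      node-current : ∀ x i → current (unitVoltages x) (node i) ≈ L i x
      node-current x i = trans (proj₂ (response (δ x)) (unitVoltages x) (admissible x) i)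
        (trans (reflexive (≡.sym (∑-def _))) (trans (∑-cong λ j → *-comm _ _) (∑-δ x (L i))))

      -- A class is either a whole superport, whose currents cancel by `current-neutral`, or a
      -- single interior vertex, where `interior-free` applies.
      class-current : ∀ x w → ∑ (λ v → δ (classLabel v) (suc w) * current (unitVoltages x) v) ≈ 0#
      class-current x w with any? (λ a → representative (suc w) ∈? superport a)
      ... | yes (a , b∈a) = trans (∑-cong λ v → member v) (trans (reflexive (∑-def _)) (current-neutral a))
        where
        open Admissible (admissible x)
        member : ∀ v → δ (classLabel v) (suc w) * ι v ≈ (if does (v ∈? superport a) then ι v else 0#)
        member v with v ∈? superport a
        ... | yes v∈a = trans (*-congʳ (reflexive (δ-≡ (classLabel v) (suc w) (≡.trans
                          (contracted⇒classLabel (≃⇒contracted (λ _ → ∈⊤) (inj₂ (a , v∈a , b∈a))))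
                          (classLabel-representative (suc w)))))) (*-identityˡ _)
        ... | no  v∉a = trans (*-congʳ (reflexive (δ-≢ (classLabel v) (suc w) λ eq → v∉a (in-a
                          (contracted⇒≃ (classLabel⇒contracted (≡.trans eq (≡.sym (classLabel-representative (suc w)))))))))) (zeroˡ _)
          where
          in-a : ∀ {v} → v ≃ representative (suc w) → v ∈ superport a
          in-a (inj₁ ≡.refl) = b∈a
          in-a (inj₂ (a′ , v∈ , b∈)) with ≡.refl ← disjoint b∈ b∈a = v∈
      ... | no interior = trans
          (∑-single (representative (suc w)) λ v v≢b → trans (*-congʳ (reflexive (δ-≢ (classLabel v) (suc w) λ eq →
            v≢b (alone (contracted⇒≃ (classLabel⇒contracted (≡.trans eq (≡.sym (classLabel-representative (suc w)))))))))) (zeroˡ _))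
          (trans (*-congˡ (interior-free _ λ a b∈a → interior (a , b∈a))) (zeroʳ _))
        where
        open Admissible (admissible x)
        alone : ∀ {v} → v ≃ representative (suc w) → v ≡ representative (suc w)
        alone (inj₁ eq)             = eq
        alone (inj₂ (a , _ , b∈)) = contradiction (a , b∈) interior

      x≈y+[x-y] : ∀ x y → x ≈ (x - y) + y
      x≈y+[x-y] x y = sym (trans (+-assoc _ _ _) (trans (+-congˡ (-‿inverseˡ y)) (+-identityʳ x)))

      voltage-base : ∀ x v → unitVoltages x v ≈ δ (node x) v + unitVoltages x (base v)
      voltage-base x v with isNode? v
      ... | no ¬node = sym (trans (+-congʳ (reflexive (δ-≢ (node x) v λ eq → ¬node (x , eq)))) (+-identityˡ _))
      ... | yes (i , ≡.refl) = trans (x≈y+[x-y] _ _) (+-congʳ (trans (Admissible.port-voltages (admissible x) i) δ-node))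
        where
        δ-node : δ x i ≈ δ (node x) (node i)
        δ-node with x ≟ᶠ i
        ... | yes ≡.refl = sym (reflexive (δ-≡ (node x) (node x) ≡.refl))
        ... | no  x≢i    = sym (reflexive (δ-≢ (node x) (node i) (x≢i ∘ node-injective)))

      -- Port voltages reduce a node to its root, and the root voltage depends only on the class. Up
      -- to the ground constant, which cancels in every voltage drop, the unit voltages have
      -- coordinates (δ x , `potential x`).
      voltage-expansion : ∀ x v → unitVoltages x v ≈
        (δ (node x) v + ∑ (λ w → potential x w * δ (classLabel v) (suc w))) + unitVoltages x (representative zero)
      voltage-expansion x v = trans (voltage-base x v) (trans (+-congˡ (begin
        unitVoltages x (base v)                         ≈⟨ reflexive (≡.cong (unitVoltages x) (base≡representative v)) ⟩
        unitVoltages x (representative (classLabel v))  ≈⟨ by-label (classLabel v) ⟩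
        ∑ (λ w → potential x w * δ (classLabel v) (suc w)) + unitVoltages x (representative zero) ∎)) (sym (+-assoc _ _ _)))
        where
        by-label : ∀ y → unitVoltages x (representative y) ≈
          ∑ (λ w → potential x w * δ y (suc w)) + unitVoltages x (representative zero)
        by-label zero    = sym (trans (+-congʳ (∑-zero λ w → zeroʳ _)) (+-identityˡ _))
        by-label (suc y) = trans (x≈y+[x-y] _ _) (+-congʳ (sym (trans (∑-cong λ w → *-comm _ _) (∑-δ y (potential x)))))

    -- By `row`, the combined row `i` pairs the currents driven by a unit voltage at port `i` with
    -- the port coordinates. The coordinate of port `j` extracts the current at that node, entry (j
    -- , i) of the minor, hence the transpose; a class coordinate extracts the total current of the
    -- class, which is zero.
    determinant-response : ∀ I →
      determinant (reducedLaplacian cond src tgt (freeLabel I)) ≈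
      det K (submatrix K L I I) * determinant (reducedLaplacian cond src tgt classLabel)
    determinant-response I = begin
      determinant (reducedLaplacian cond src tgt (freeLabel I))
        ≈⟨ determinant-portVector I ⟨
      determinant M
        ≈⟨ determinant-block d M Z (λ i j → submatrix K L I I j i)
             (λ i j → trans (row i (j ↑ˡ classRank)) (trans
               (∑-cong λ v → *-congʳ (portVector-↑ˡ I v j))
               (trans (∑-δ (freeNode I j) (current (unitVoltages (element I i)))) (node-current (element I i) (element I j)))))
             (λ i w → trans (row i (d ↑ʳ w)) (trans
               (∑-cong λ v → *-congʳ (portVector-↑ʳ I v w))
               (class-current (element I i) w))) ⟩
      determinant (λ i j → submatrix K L I I j i) * determinant (λ v w → M (d ↑ʳ v) (d ↑ʳ w))
        ≈⟨ *-cong (trans (determinant-transpose (submatrix K L I I)) (reflexive (determinant-def _)))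
             (determinant-cong λ v w → ∑-cong λ e → *-congˡ (*-cong (block e v) (block e w))) ⟩
      det K (submatrix K L I I) * determinant (reducedLaplacian cond src tgt classLabel) ∎
      where
      d : ℕ
      d = ∣ I ∣
      β : Matrix K m (d +ᴺ classRank)
      β = edgeVectors (portVector I) src tgt
      M : Matrix K (d +ᴺ classRank) (d +ᴺ classRank)
      M = gram cond β
      Z : Matrix K d classRank
      Z i = potential (element I i)
      block : ∀ e w → β e (d ↑ʳ w) ≈ edgeVectors (labelVector classLabel) src tgt e w
      block e w = +-cong (portVector-↑ʳ I (src e) w) (-‿cong (portVector-↑ʳ I (tgt e) w))
      voltage-drop : ∀ i e → β e (i ↑ˡ classRank) + ∑ (λ w → Z i w * β e (d ↑ʳ w)) ≈
        unitVoltages (element I i) (src e) - unitVoltages (element I i) (tgt e)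
      voltage-drop i e = begin
        β e (i ↑ˡ classRank) + ∑ (λ w → Z i w * β e (d ↑ʳ w))
          ≈⟨ +-cong (+-cong (portVector-↑ˡ I _ i) (-‿cong (portVector-↑ˡ I _ i)))
               (trans (∑-cong λ w → trans (*-congˡ (block e w)) (trans (distribˡ _ _ _) (+-congˡ (sym (-‿distribʳ-* _ _)))))
                 (∑-difference _ _)) ⟩
        (a (src e) - a (tgt e)) + (b (src e) - b (tgt e))
          ≈⟨ shift (a (src e)) (a (tgt e)) (b (src e)) (b (tgt e)) (U (representative zero)) ⟩
        ((a (src e) + b (src e)) + U (representative zero)) - ((a (tgt e) + b (tgt e)) + U (representative zero))
          ≈⟨ +-cong (voltage-expansion (element I i) (src e)) (-‿cong (voltage-expansion (element I i) (tgt e))) ⟨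
        U (src e) - U (tgt e) ∎
        where
        U a b : Vector Carrier n
        U = unitVoltages (element I i)
        a v = δ (freeNode I i) v
        b v = ∑ λ w → Z i w * δ (classLabel v) (suc w)
        shift : ∀ a a′ b b′ g → (a - a′) + (b - b′) ≈ ((a + b) + g) - ((a′ + b′) + g)
        shift a a′ b b′ g = begin
          (a - a′) + (b - b′)                 ≈⟨ +.interchange a (- a′) b (- b′) ⟩
          (a + b) + (- a′ + - b′)             ≈⟨ +-congˡ (-‿+-comm a′ b′) ⟩
          (a + b) - (a′ + b′)                 ≈⟨ +-congʳ (trans (+-congˡ (-‿inverseʳ g)) (+-identityʳ _)) ⟨
          (a + b) + (g - g) - (a′ + b′)       ≈⟨ +-congʳ (+-assoc _ _ _) ⟨
          (a + b) + g - g - (a′ + b′)         ≈⟨ +-assoc _ _ _ ⟩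
          (a + b) + g + (- g - (a′ + b′))     ≈⟨ +-congˡ (trans (+-comm _ _) (-‿+-comm (a′ + b′) g)) ⟩
          ((a + b) + g) - ((a′ + b′) + g)     ∎
      -- Combining rows of the Gram matrix combines the left edge vectors, which become the voltage
      -- drops of the unit voltages; `∑-current` then turns the sum over edges into one over
      -- vertices.
      row : ∀ i k → M (i ↑ˡ classRank) k + ∑ (λ w → Z i w * M (d ↑ʳ w) k) ≈
        ∑ λ v → portVector I v k * current (unitVoltages (element I i)) v
      row i k = begin
        M (i ↑ˡ classRank) k + ∑ (λ w → Z i w * ∑ (λ e → cond e * (β e (d ↑ʳ w) * β e k)))
          ≈⟨ +-congˡ (trans (∑-exchange (Z i) cond (λ e w → β e (d ↑ʳ w) * β e k))
               (∑-cong λ e → *-congˡ (trans (∑-cong λ w → sym (*-assoc _ _ _)) (sym (*-distribʳ-∑ (β e k) _))))) ⟩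
        ∑ (λ e → cond e * (β e (i ↑ˡ classRank) * β e k)) +
        ∑ (λ e → cond e * (∑ (λ w → Z i w * β e (d ↑ʳ w)) * β e k))
          ≈⟨ ∑-distrib-+ _ _ ⟨
        ∑ (λ e → cond e * (β e (i ↑ˡ classRank) * β e k) + cond e * (∑ (λ w → Z i w * β e (d ↑ʳ w)) * β e k))
          ≈⟨ ∑-cong (λ e → trans (sym (distribˡ _ _ _)) (*-congˡ (trans (sym (distribʳ _ _ _))
               (trans (*-congʳ (voltage-drop i e)) (*-comm _ _))))) ⟩
        ∑ (λ e → cond e * (β e k * (U (src e) - U (tgt e))))
          ≈⟨ ∑-current (λ v → portVector I v k) U ⟨
        ∑ (λ v → portVector I v k * current U v) ∎
        where
        U : Vector Carrier n
        U = unitVoltages (element I i)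

    -- The matrix-tree theorem is read off twice, for the labels with free nodes and for the class
    -- labels. The split on `nonempty?` follows the two clauses of `Ψ`.
    response-minor : ∀ I → Ψ K G cond S I ≈ det K (submatrix K L I I) * Φ-valid K G cond S
    response-minor I = trans (sym tree-sum) (trans (determinant-response I) (*-congˡ
      (matrix-tree cond src tgt classLabel classLabel-surjective (isValid? G S) (valid⇔tree-class G S))))
      where
      tree-sum : determinant (reducedLaplacian cond src tgt (freeLabel I)) ≈ Ψ K G cond S I
      tree-sum with nonempty? I
      ... | yes _    = matrix-tree cond src tgt (freeLabel I) (freeLabel-surjective I)
        (contributes? G S I) (contributes⇔tree G S I)
      ... | no empty = matrix-tree cond src tgt (freeLabel I) (freeLabel-surjective I)
        (isValid? G S) (valid⇔tree-free G S I empty)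

  Φ-valid#0 : (∀ e → 0# < cond e) → Φ-valid K G cond S # 0#
  Φ-valid#0 cond>0 = Equivalence.from #⇔<⊎> (inj₂ (∑Subsets-weight-pos cond cond>0 (isValid? G S) (valid-exists G S)))

  divide-cancel : ∀ {x y z} (z#0 : z # 0#) → y ≈ x * z → x ≈ divide y z z#0
  divide-cancel {x} {y} {z} z#0 y≈xz = sym (begin
    y * z⁻¹               ≈⟨ *-congʳ y≈xz ⟩
    x * z * z⁻¹           ≈⟨ *-assoc x z z⁻¹ ⟩
    -- Apartness from 0 provides an inverse of `z - 0#`, so the difference has to be inserted before
    -- cancelling.
    x * (z * z⁻¹)         ≈⟨ *-congˡ (*-congʳ (trans (+-congˡ -0#≈0#) (+-identityʳ z))) ⟨
    x * ((z - 0#) * z⁻¹)  ≈⟨ *-congˡ (proj₂ (proj₂ (#⇒invertible z#0))) ⟩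
    x * 1#                ≈⟨ *-identityʳ x ⟩
    x                     ∎)
    where
    z⁻¹ : Carrier
    z⁻¹ = proj₁ (#⇒invertible z#0)

corollary5p3 : ∀ {c ℓ₁ ℓ₂} (K : OrderedField c ℓ₁ ℓ₂) → let open OrderedField K in
    ∀ {n m p q : ℕ} (G : SimpleGraph n m) (cond : Fin m → Carrier) →
    (∀ e → 0# < cond e) →
    (S : Superports n p q) (L : Matrix K q q) →
    IsResponseMatrix K G cond S L →
    Σ[ Φ#0 ∈ Φ-valid K G cond S # 0# ]
    (∀ (I : Subset q) →
    det K (submatrix K L I I) ≈ divide (Ψ K G cond S I) (Φ-valid K G cond S) Φ#0)
corollary5p3 K G cond cond>0 S L response =
  Φ-valid#0 cond>0 , λ I → divide-cancel (Φ-valid#0 cond>0) (response-minor L response I)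
  where open ResponseMatrix K G cond S
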